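{- Let $K$ be a number field (a finite extension of $\mathbb{Q}$) and let $C\subseteq\omega$ be a cohesive set. If $K/\mathbb{Q}$ is Galois, then $\prod_C K/\prod_C\mathbb{Q}$ is Galois, and thus $\mathrm{Gal}(\prod_C K/\prod_C\mathbb{Q})\cong\mathrm{Gal}(K/\mathbb{Q})$.
   Context: For $A,B\subseteq\omega$, $A\subseteq^* B$ means $A\setminus B$ is finite. A set $C\subseteq\omega$ is cohesive if it is infinite and for every c.e. set $W$ either $C\subseteq^*W$ or $C\subseteq^*\overline{W}$. A computable structure has computable domain $\subseteq\omega$ and computable atomic diagram. For a computable structure $\mathcal A$ and cohesive $C$, the cohesive power $\prod_C\mathcal A$ has as domain the classes $[\varphi]$ of partial computable functions $\varphi$ from $\omega$ to $\mathcal{A}$ with $C\subseteq^*\mathrm{dom}(\varphi)$, where $[\varphi]=[\psi]$ iff $C\subseteq^*\{i:\varphi(i){\downarrow}=\psi(i){\downarrow}\}$; functions and constants are interpreted pointwise, and a relation $R$ holds of $[\varphi_0],\dots,[\varphi_{m-1}]$ iff $C\subseteq^*\{i: R^{\mathcal A}(\varphi_0(i),\dots,\varphi_{m-1}(i))\}$. $K$ is given a computable presentation as a field; $\prod_C\mathbb{Q}$ is regarded as the subfield of $\prod_CK$ of classes of partial computable functions with values in $\mathbb{Q}\subseteq K$. -}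

module Defs where

open import Algebra.Bundles using (CommutativeRing; Group)
open import Algebra.Morphism.Structures
  using (IsRingHomomorphism; IsRingIsomorphism; IsGroupIsomorphism)
import Algebra.Morphism.Construct.Composition as Composition
import Algebra.Morphism.Construct.Identity as Identity
import Algebra.Properties.Semiring.Exp as Exp
import Algebra.Properties.Semiring.Sum as Sum
open import Data.Empty using (⊥-elim)
open import Data.Fin.Base using (Fin; toℕ)
open import Data.List.Base using (List; []; _++_)
open import Data.List.Membership.Propositional using (_∈_)
open import Data.List.Membership.Propositional.Properties using (∈-++⁺ˡ; ∈-++⁺ʳ)
open import Data.List.Membership.DecPropositional using () renaming (_∈?_ to mem?)
open import Data.Nat.Base using (ℕ; zero; suc; _<_)
open import Data.Nat.Properties using (<-cmp; _≟_)
open import Data.Product.Base using (∃-syntax; Σ-syntax; _×_; _,_; proj₁; proj₂)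
open import Data.Rational.Base using (ℚ) renaming (+-*-rawRing to ℚ-rawRing)
open import Data.Sum.Base using (_⊎_)
open import Data.Vec.Base using (Vec; []; _∷_; lookup)
open import Data.Vec.Functional using (Vector)
open import Data.Vec.Relation.Binary.Pointwise.Inductive using (Pointwise; []; _∷_)
open import Function.Bundles using (_⇔_)
open import Function.Base using (id; _∘_)
open import Level using (0ℓ)
open import Relation.Binary.Definitions using (tri<; tri≈; tri>)
open import Relation.Binary.PropositionalEquality.Core as ≡ using (_≡_; refl)
open import Relation.Nullary using (¬_; yes; no)
open import Relation.Unary using (Pred; ∁; _∖_; _∩_; _⊆_)

-- Partial computable functions are Kleene's μ-recursive functions.
data PR : ℕ → Set where
  zer  : ∀ {k} → PR k
  suc  : PR 1
  proj : ∀ {k} → Fin k → PR k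
  comp : ∀ {k m} → PR m → Vec (PR k) m → PR k
  prec : ∀ {k} → PR k → PR (suc (suc k)) → PR (suc k)
  mu   : ∀ {k} → PR (suc k) → PR k

infix 4 _[_]⇓_

-- f [ xs ]⇓ y : the computation of f on xs halts with value y.
-- In prec the recursion variable is the first argument and the step function
-- receives it followed by the previous value.  In mu the searched variable is
-- the first argument, and the search diverges if the body does before a zero
-- is found.
data _[_]⇓_ : ∀ {k} → PR k → Vec ℕ k → ℕ → Set where
  ⇓zer   : ∀ {k} {xs : Vec ℕ k} → zer [ xs ]⇓ 0
  ⇓suc   : ∀ {x} → suc [ x ∷ [] ]⇓ suc x
  ⇓proj  : ∀ {k} {i : Fin k} {xs} → proj i [ xs ]⇓ lookup xs i
  ⇓comp  : ∀ {k m} {f : PR m} {gs : Vec (PR k) m} {xs ys z} →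
           Pointwise (λ g y → g [ xs ]⇓ y) gs ys → f [ ys ]⇓ z →
           comp f gs [ xs ]⇓ z
  ⇓prec0 : ∀ {k} {f : PR k} {g xs z} →
           f [ xs ]⇓ z → prec f g [ 0 ∷ xs ]⇓ z
  ⇓precS : ∀ {k} {f : PR k} {g xs n y z} →
           prec f g [ n ∷ xs ]⇓ y → g [ n ∷ y ∷ xs ]⇓ z →
           prec f g [ suc n ∷ xs ]⇓ z
  ⇓mu    : ∀ {k} {f : PR (suc k)} {xs n} →
           f [ n ∷ xs ]⇓ 0 →
           (∀ {m} → m < n → ∃[ v ] f [ m ∷ xs ]⇓ suc v) →
           mu f [ xs ]⇓ n

mutual
  ⇓-det : ∀ {k} {f : PR k} {xs y z} → f [ xs ]⇓ y → f [ xs ]⇓ z → y ≡ z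
  ⇓-det ⇓zer         ⇓zer         = refl
  ⇓-det ⇓suc         ⇓suc         = refl
  ⇓-det ⇓proj        ⇓proj        = refl
  ⇓-det (⇓comp ps p) (⇓comp qs q) with refl ← ⇓-dets ps qs = ⇓-det p q
  ⇓-det (⇓prec0 p)   (⇓prec0 q)   = ⇓-det p q
  ⇓-det (⇓precS p r) (⇓precS q s) with refl ← ⇓-det p q = ⇓-det r s
  ⇓-det (⇓mu {n = m} p below) (⇓mu {n = n} q below′) with <-cmp m n
  ... | tri≈ _ m≡n _ = m≡n
  ... | tri< m<n _ _ with () ← ⇓-det p (proj₂ (below′ m<n))
  ... | tri> _ _ n<m with () ← ⇓-det (proj₂ (below n<m)) q

  ⇓-dets : ∀ {k m} {gs : Vec (PR k) m} {xs ys zs} →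
           Pointwise (λ g y → g [ xs ]⇓ y) gs ys →
           Pointwise (λ g y → g [ xs ]⇓ y) gs zs → ys ≡ zs
  ⇓-dets []       []       = refl
  ⇓-dets (p ∷ ps) (q ∷ qs) = ≡.cong₂ _∷_ (⇓-det p q) (⇓-dets ps qs)

constPR : ∀ {k} → ℕ → PR k
constPR zero    = zer
constPR (suc n) = comp suc (constPR n ∷ [])

⇓const : ∀ {k} n {xs : Vec ℕ k} → constPR n [ xs ]⇓ n
⇓const zero    = ⇓zer
⇓const (suc n) = ⇓comp (⇓const n ∷ []) ⇓suc

Dom : PR 1 → Pred ℕ 0ℓ
Dom φ i = ∃[ y ] φ [ i ∷ [] ]⇓ y

CE : Pred ℕ 0ℓ → Set
CE W = ∃[ φ ] ∀ i → W i ⇔ Dom φ i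

Computable : Pred ℕ 0ℓ → Set
Computable D = Σ[ χ ∈ PR 1 ] ∀ n →
  (D n → χ [ n ∷ [] ]⇓ 1) × (¬ D n → χ [ n ∷ [] ]⇓ 0)

Finite : Pred ℕ 0ℓ → Set
Finite P = Σ[ xs ∈ List ℕ ] P ⊆ (_∈ xs)

infix 4 _⊆*_

_⊆*_ : Pred ℕ 0ℓ → Pred ℕ 0ℓ → Set
A ⊆* B = Finite (A ∖ B)

Cohesive : Pred ℕ 0ℓ → Set₁
Cohesive C = ¬ Finite C × (∀ W → CE W → C ⊆* W ⊎ C ⊆* ∁ W)

module _ {C : Pred ℕ 0ℓ} where

  ⊆*-univ : ∀ {A} → (∀ i → A i) → C ⊆* A
  ⊆*-univ a = [] , λ {i} (_ , ¬a) → ⊥-elim (¬a (a i))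

  ⊆*-mono : ∀ {A B} → A ⊆ B → C ⊆* A → C ⊆* B
  ⊆*-mono A⊆B (xs , f) = xs , λ (c , ¬b) → f (c , λ a → ¬b (A⊆B a))

  ⊆*-∩ : ∀ {A B} → C ⊆* A → C ⊆* B → C ⊆* (A ∩ B)
  ⊆*-∩ {A} {B} (xs , f) (ys , g) = xs ++ ys , go
    where
    go : (C ∖ (A ∩ B)) ⊆ (_∈ (xs ++ ys))
    go {i} (c , ¬ab) with mem? _≟_ i xs | mem? _≟_ i ys
    ... | yes i∈xs | _        = ∈-++⁺ˡ i∈xs
    ... | no _     | yes i∈ys = ∈-++⁺ʳ xs i∈ys
    ... | no i∉xs  | no i∉ys  =
      ⊥-elim (i∉xs (f (c , λ a → i∉ys (g (c , λ b → ¬ab (a , b))))))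

-- A field extension L/F is given by L together with F as a subset of L.

module _ (L : CommutativeRing 0ℓ 0ℓ) where
  open CommutativeRing L
    renaming (_+_ to _⊕_; _*_ to _⊗_; -_ to ⊖_; refl to ≈-refl)
  open Sum semiring using (sum)
  open Exp semiring using (_^_)

  record IsField : Set where
    field
      0≉1      : ¬ 0# ≈ 1#
      inverses : ∀ x → ¬ x ≈ 0# → ∃[ y ] x ⊗ y ≈ 1#

  module _ (F : Pred Carrier 0ℓ) where

    record IsSubfield : Set where
      field
        resp     : ∀ {x y} → x ≈ y → F x → F y
        0∈       : F 0#
        1∈       : F 1#
        +-closed : ∀ {x y} → F x → F y → F (x ⊕ y)
        *-closed : ∀ {x y} → F x → F y → F (x ⊗ y)
        neg-closed : ∀ {x} → F x → F (⊖ x)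
        inv-closed : ∀ {x y} → F x → x ⊗ y ≈ 1# → F y

    -- Finite degree: L has a finite basis as an F-vector space.
    FiniteDegree : Set
    FiniteDegree = Σ[ n ∈ ℕ ] Σ[ e ∈ Vector Carrier n ]
      (∀ x → Σ[ c ∈ Vector Carrier n ]
        (∀ j → F (c j)) × x ≈ sum (λ j → c j ⊗ e j)) ×
      (∀ (c : Vector Carrier n) → (∀ j → F (c j)) →
        sum (λ j → c j ⊗ e j) ≈ 0# → ∀ j → c j ≈ 0#)

    -- x is a root of a nonzero polynomial with coefficients in F.
    IsAlgebraic : Pred Carrier 0ℓ
    IsAlgebraic x = Σ[ n ∈ ℕ ] Σ[ a ∈ Vector Carrier n ]
      (∀ j → F (a j)) × (∃[ j ] ¬ a j ≈ 0#) × sum (λ j → a j ⊗ x ^ toℕ j) ≈ 0#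

    record Aut : Set where
      field
        to    : Carrier → Carrier
        isIso : IsRingIsomorphism rawRing rawRing to
        fixes : ∀ {x} → F x → to x ≈ x
      open IsRingIsomorphism isIso public

      from : Carrier → Carrier
      from y = proj₁ (surjective y)

      to∘from : ∀ y → to (from y) ≈ y
      to∘from y = proj₂ (surjective y) ≈-refl

    open Aut

    idAut : Aut
    idAut = record
      { to    = id
      ; isIso = Identity.isRingIsomorphism rawRing ≈-refl
      ; fixes = λ _ → ≈-refl
      }

    _∘Aut_ : Aut → Aut → Aut
    σ ∘Aut τ = record
      { to    = to σ ∘ to τ
      ; isIso = Composition.isRingIsomorphism trans (isIso τ) (isIso σ)
      ; fixes = λ x∈F → trans (⟦⟧-cong σ (fixes τ x∈F)) (fixes σ x∈F)
      }

    invAut : Aut → Aut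
    invAut σ = record
      { to    = from σ
      ; isIso = record
        { isRingMonomorphism = record
          { isRingHomomorphism = record
            { isSemiringHomomorphism = record
              { isNearSemiringHomomorphism = record
                { +-isMonoidHomomorphism = record
                  { isMagmaHomomorphism = record
                    { isRelHomomorphism = record { cong = cong′ }
                    ; homo = λ x y → cancel (trans (to∘from σ _)
                        (sym (trans (+-homo σ _ _)
                                    (+-cong (to∘from σ x) (to∘from σ y)))))
                    }
                  ; ε-homo = cancel (trans (to∘from σ _) (sym (0#-homo σ)))
                  }
                ; *-homo = λ x y → cancel (trans (to∘from σ _)
                    (sym (trans (*-homo σ _ _)
                                (*-cong (to∘from σ x) (to∘from σ y)))))
                }
              ; 1#-homo = cancel (trans (to∘from σ _) (sym (1#-homo σ)))
              }
            ; -‿homo = λ x → cancel (trans (to∘from σ _)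
                (sym (trans (-‿homo σ _) (-‿cong (to∘from σ x)))))
            }
          ; injective = λ {x} {y} p →
              trans (sym (to∘from σ x)) (trans (⟦⟧-cong σ p) (to∘from σ y))
          }
        ; surjective = λ x → to σ x , λ p →
            cancel (trans (to∘from σ _) p)
        }
      ; fixes = λ x∈F → cancel (trans (to∘from σ _) (sym (fixes σ x∈F)))
      }
      where
      cancel : ∀ {x y} → to σ x ≈ to σ y → x ≈ y
      cancel = injective σ

      cong′ : ∀ {x y} → x ≈ y → from σ x ≈ from σ y
      cong′ p = cancel (trans (to∘from σ _) (trans p (sym (to∘from σ _))))

    -- Gal(L/F): the F-automorphisms of L under composition.
    Gal : Group 0ℓ 0ℓ
    Gal = record
      { Carrier = Aut
      ; _≈_     = λ σ τ → ∀ x → to σ x ≈ to τ x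
      ; _∙_     = _∘Aut_
      ; ε       = idAut
      ; _⁻¹     = invAut
      ; isGroup = record
        { isMonoid = record
          { isSemigroup = record
            { isMagma = record
              { isEquivalence = record
                { refl  = λ _ → ≈-refl
                ; sym   = λ p x → sym (p x)
                ; trans = λ p q x → trans (p x) (q x)
                }
              ; ∙-cong = λ {σ} {σ′} {τ} {τ′} p q x →
                  trans (⟦⟧-cong σ (q x)) (p (to τ′ x))
              }
            ; assoc = λ _ _ _ _ → ≈-refl
            }
          ; identity = (λ _ _ → ≈-refl) , (λ _ _ → ≈-refl)
          }
        ; inverse = (λ σ x → injective σ (to∘from σ (to σ x)))
                  , (λ σ x → to∘from σ x)
        ; ⁻¹-cong = λ {σ} {τ} p x → injective σ
            (trans (to∘from σ x)
                   (sym (trans (p (from τ x)) (to∘from τ x))))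
        }
      }

    -- L/F is a field extension that is algebraic and such that F is exactly
    -- the fixed field of Gal(L/F).
    record IsGalois : Set where
      field
        isField    : IsField
        isSubfield : IsSubfield
        algebraic  : ∀ x → IsAlgebraic x
        fixedField : ∀ x → (∀ σ → to σ x ≈ x) → F x

infix 4 _≅_

_≅_ : Group 0ℓ 0ℓ → Group 0ℓ 0ℓ → Set
G ≅ H = ∃[ f ] IsGroupIsomorphism (Group.rawGroup G) (Group.rawGroup H) f

record IsNumberField (K : CommutativeRing 0ℓ 0ℓ) : Set where
  open CommutativeRing K
  field
    isField : IsField K
    ι       : ℚ → Carrier
    ι-homo  : IsRingHomomorphism ℚ-rawRing rawRing ι

  ratl : Pred Carrier 0ℓ
  ratl x = ∃[ q ] ι q ≈ x

  field
    finiteDegree : FiniteDegree K ratl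

-- An isomorphism, code, of K onto a structure with computable domain ⊆ ω and
-- computable operations.  Equality on the copy is equality of numbers, so
-- this amounts to a computable atomic diagram.  The programs for the
-- operations are unconstrained off the domain.
record ComputablePresentation (K : CommutativeRing 0ℓ 0ℓ) : Set where
  open CommutativeRing K renaming (_+_ to _⊕_; _*_ to _⊗_; -_ to ⊖_)
  field
    code           : Carrier → ℕ
    code-cong      : ∀ {x y} → x ≈ y → code x ≡ code y
    code-injective : ∀ {x y} → code x ≡ code y → x ≈ y

  Domain : Pred ℕ 0ℓ
  Domain n = ∃[ x ] code x ≡ n

  field
    domain-computable : Computable Domain
    addPR : PR 2
    mulPR : PR 2
    negPR : PR 1
    addPR-correct : ∀ x y → addPR [ code x ∷ code y ∷ [] ]⇓ code (x ⊕ y)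
    mulPR-correct : ∀ x y → mulPR [ code x ∷ code y ∷ [] ]⇓ code (x ⊗ y)
    negPR-correct : ∀ x → negPR [ code x ∷ [] ]⇓ code (⊖ x)

module _ {K : CommutativeRing 0ℓ 0ℓ} (P : ComputablePresentation K)
         (C : Pred ℕ 0ℓ) where

  open CommutativeRing K renaming
    ( _+_ to _⊕_; _*_ to _⊗_; -_ to ⊖_; refl to ≈-refl; sym to ≈-sym
    ; trans to ≈-trans)
  open ComputablePresentation P

  -- Representatives: partial computable functions from ω to K whose domain
  -- almost contains C.
  record PCF : Set where
    field
      prog   : PR 1
      valued : ∀ {i y} → prog [ i ∷ [] ]⇓ y → Domain y
      domain : C ⊆* Dom prog
  open PCF

  infix 4 _⟨_⟩↦_ _≋_

  _⟨_⟩↦_ : PCF → ℕ → Carrier → Set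
  φ ⟨ i ⟩↦ x = prog φ [ i ∷ [] ]⇓ code x

  _≋_ : PCF → PCF → Set
  φ ≋ ψ = C ⊆* λ i → ∃[ y ] prog φ [ i ∷ [] ]⇓ y × prog ψ [ i ∷ [] ]⇓ y

  value : ∀ φ {i} → Dom (prog φ) i → ∃[ x ] φ ⟨ i ⟩↦ x
  value φ (y , p) with valued φ p
  ... | x , refl = x , p

  defined : ∀ φ → C ⊆* λ i → ∃[ x ] φ ⟨ i ⟩↦ x
  defined φ = ⊆*-mono (value φ) (domain φ)

  resp↦ : ∀ φ {i x y} → x ≈ y → φ ⟨ i ⟩↦ x → φ ⟨ i ⟩↦ y
  resp↦ φ x≈y p = ≡.subst (prog φ [ _ ]⇓_) (code-cong x≈y) p

  unary : (f : Carrier → Carrier) (F : PR 1) →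
          (∀ x → F [ code x ∷ [] ]⇓ code (f x)) → PCF → PCF
  unary f F F-ok φ = record
    { prog   = comp F (prog φ ∷ [])
    ; valued = λ { (⇓comp (p ∷ []) r) → val (valued φ p) r }
    ; domain = ⊆*-mono (λ (x , p) → code (f x) , ⇓comp (p ∷ []) (F-ok x))
                       (defined φ)
    }
    where
    val : ∀ {a z} → Domain a → F [ a ∷ [] ]⇓ z → Domain z
    val (x , refl) r = f x , ⇓-det (F-ok x) r

  binary : (f : Carrier → Carrier → Carrier) (F : PR 2) →
           (∀ x y → F [ code x ∷ code y ∷ [] ]⇓ code (f x y)) →
           PCF → PCF → PCF
  binary f F F-ok φ ψ = record
    { prog   = comp F (prog φ ∷ prog ψ ∷ [])
    ; valued = λ { (⇓comp (p ∷ q ∷ []) r) → val (valued φ p) (valued ψ q) r }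
    ; domain = ⊆*-mono
        (λ ((x , p) , (y , q)) →
           code (f x y) , ⇓comp (p ∷ q ∷ []) (F-ok x y))
        (⊆*-∩ (defined φ) (defined ψ))
    }
    where
    val : ∀ {a b z} → Domain a → Domain b → F [ a ∷ b ∷ [] ]⇓ z → Domain z
    val (x , refl) (y , refl) r = f x y , ⇓-det (F-ok x y) r

  const : Carrier → PCF
  const x = record
    { prog   = constPR (code x)
    ; valued = λ p → x , ⇓-det (⇓const (code x)) p
    ; domain = ⊆*-univ λ _ → code x , ⇓const (code x)
    }

  _+ᶜ_ _*ᶜ_ : PCF → PCF → PCF
  _+ᶜ_ = binary _⊕_ addPR addPR-correct
  _*ᶜ_ = binary _⊗_ mulPR mulPR-correct

  -ᶜ_ : PCF → PCF
  -ᶜ_ = unary ⊖_ negPR negPR-correct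

  const↦ : ∀ x {i} → const x ⟨ i ⟩↦ x
  const↦ x = ⇓const (code x)

  add↦ : ∀ φ ψ {i x y} → φ ⟨ i ⟩↦ x → ψ ⟨ i ⟩↦ y → (φ +ᶜ ψ) ⟨ i ⟩↦ (x ⊕ y)
  add↦ _ _ p q = ⇓comp (p ∷ q ∷ []) (addPR-correct _ _)

  mul↦ : ∀ φ ψ {i x y} → φ ⟨ i ⟩↦ x → ψ ⟨ i ⟩↦ y → (φ *ᶜ ψ) ⟨ i ⟩↦ (x ⊗ y)
  mul↦ _ _ p q = ⇓comp (p ∷ q ∷ []) (mulPR-correct _ _)

  neg↦ : ∀ φ {i x} → φ ⟨ i ⟩↦ x → (-ᶜ φ) ⟨ i ⟩↦ (⊖ x)
  neg↦ _ p = ⇓comp (p ∷ []) (negPR-correct _)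

  agree : ∀ φ ψ {i x y} → x ≈ y → φ ⟨ i ⟩↦ x → ψ ⟨ i ⟩↦ y →
          ∃[ v ] prog φ [ i ∷ [] ]⇓ v × prog ψ [ i ∷ [] ]⇓ v
  agree φ ψ {y = y} x≈y p q = code y , resp↦ φ x≈y p , q

  ≋-refl : ∀ {φ} → φ ≋ φ
  ≋-refl {φ} = ⊆*-mono (λ (y , p) → y , p , p) (domain φ)

  ≋-sym : ∀ {φ ψ} → φ ≋ ψ → ψ ≋ φ
  ≋-sym = ⊆*-mono λ (y , p , q) → y , q , p

  ≋-trans : ∀ {φ ψ χ} → φ ≋ ψ → ψ ≋ χ → φ ≋ χ
  ≋-trans {φ} a b = ⊆*-mono
    (λ ((y , p , q) , (z , r , s)) →
       z , ≡.subst (prog φ [ _ ]⇓_) (⇓-det q r) p , s)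
    (⊆*-∩ a b)

  unary-cong : ∀ f F F-ok {φ φ′} → φ ≋ φ′ → unary f F F-ok φ ≋ unary f F F-ok φ′
  unary-cong f F F-ok {φ} a = ⊆*-mono
    (λ { ((y , p , p′)) → go (valued φ p) p p′ }) a
    where
    go : ∀ {i y φ φ′} → Domain y → φ [ i ∷ [] ]⇓ y → φ′ [ i ∷ [] ]⇓ y →
         ∃[ v ] comp F (φ ∷ []) [ i ∷ [] ]⇓ v × comp F (φ′ ∷ []) [ i ∷ [] ]⇓ v
    go (x , refl) p p′ =
      _ , ⇓comp (p ∷ []) (F-ok x) , ⇓comp (p′ ∷ []) (F-ok x)

  binary-cong : ∀ f F F-ok {φ φ′ ψ ψ′} → φ ≋ φ′ → ψ ≋ ψ′ →
                binary f F F-ok φ ψ ≋ binary f F F-ok φ′ ψ′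
  binary-cong f F F-ok {φ} {ψ = ψ} a b = ⊆*-mono
    (λ { ((_ , p , p′) , (_ , q , q′)) →
         go (valued φ p) (valued ψ q) p p′ q q′ })
    (⊆*-∩ a b)
    where
    go : ∀ {i y z φ φ′ ψ ψ′} → Domain y → Domain z →
         φ [ i ∷ [] ]⇓ y → φ′ [ i ∷ [] ]⇓ y →
         ψ [ i ∷ [] ]⇓ z → ψ′ [ i ∷ [] ]⇓ z →
         ∃[ v ] comp F (φ ∷ ψ ∷ []) [ i ∷ [] ]⇓ v ×
                comp F (φ′ ∷ ψ′ ∷ []) [ i ∷ [] ]⇓ v
    go (x , refl) (w , refl) p p′ q q′ =
      _ , ⇓comp (p ∷ q ∷ []) (F-ok x w) , ⇓comp (p′ ∷ q′ ∷ []) (F-ok x w)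

  law₁ : ∀ φ l r → (∀ {i x} → φ ⟨ i ⟩↦ x →
           ∃[ v ] prog l [ i ∷ [] ]⇓ v × prog r [ i ∷ [] ]⇓ v) → l ≋ r
  law₁ φ l r h = ⊆*-mono (λ (_ , p) → h p) (defined φ)

  law₂ : ∀ φ ψ l r → (∀ {i x y} → φ ⟨ i ⟩↦ x → ψ ⟨ i ⟩↦ y →
           ∃[ v ] prog l [ i ∷ [] ]⇓ v × prog r [ i ∷ [] ]⇓ v) → l ≋ r
  law₂ φ ψ l r h = ⊆*-mono (λ ((_ , p) , (_ , q)) → h p q)
                           (⊆*-∩ (defined φ) (defined ψ))

  law₃ : ∀ φ ψ χ l r →
         (∀ {i x y z} → φ ⟨ i ⟩↦ x → ψ ⟨ i ⟩↦ y → χ ⟨ i ⟩↦ z →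
           ∃[ v ] prog l [ i ∷ [] ]⇓ v × prog r [ i ∷ [] ]⇓ v) → l ≋ r
  law₃ φ ψ χ l r h = ⊆*-mono
    (λ ((_ , p) , (_ , q) , (_ , s)) → h p q s)
    (⊆*-∩ (defined φ) (⊆*-∩ (defined ψ) (defined χ)))

  -- The cohesive power of K over C, with equality of classes as its setoid
  -- equality.  It is a ring for every C; that it is a field uses cohesiveness.
  ∏ : CommutativeRing 0ℓ 0ℓ
  ∏ = record
    { Carrier = PCF
    ; _≈_ = _≋_
    ; _+_ = _+ᶜ_
    ; _*_ = _*ᶜ_
    ; -_  = -ᶜ_
    ; 0#  = const 0#
    ; 1#  = const 1#
    ; isCommutativeRing = record
      { isRing = record
        { +-isAbelianGroup = record
          { isGroup = record
            { isMonoid = record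
              { isSemigroup = record
                { isMagma = record
                  { isEquivalence = record
                    { refl  = λ {φ} → ≋-refl {φ}
                    ; sym   = λ {φ} {ψ} → ≋-sym {φ} {ψ}
                    ; trans = λ {φ} {ψ} {χ} → ≋-trans {φ} {ψ} {χ}
                    }
                  ; ∙-cong = λ {φ} {φ′} {ψ} {ψ′} →
                      binary-cong _⊕_ addPR addPR-correct {φ} {φ′} {ψ} {ψ′}
                  }
                ; assoc = λ φ ψ χ →
                    law₃ φ ψ χ ((φ +ᶜ ψ) +ᶜ χ) (φ +ᶜ (ψ +ᶜ χ)) λ p q s →
                    agree ((φ +ᶜ ψ) +ᶜ χ) (φ +ᶜ (ψ +ᶜ χ)) (+-assoc _ _ _)
                      (add↦ (φ +ᶜ ψ) χ (add↦ φ ψ p q) s)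
                      (add↦ φ (ψ +ᶜ χ) p (add↦ ψ χ q s))
                }
              ; identity =
                  (λ φ → law₁ φ (const 0# +ᶜ φ) φ λ p →
                    agree (const 0# +ᶜ φ) φ (+-identityˡ _)
                      (add↦ (const 0#) φ (const↦ 0#) p) p)
                , (λ φ → law₁ φ (φ +ᶜ const 0#) φ λ p →
                    agree (φ +ᶜ const 0#) φ (+-identityʳ _)
                      (add↦ φ (const 0#) p (const↦ 0#)) p)
              }
            ; inverse =
                (λ φ → law₁ φ ((-ᶜ φ) +ᶜ φ) (const 0#) λ p →
                  agree ((-ᶜ φ) +ᶜ φ) (const 0#) (-‿inverseˡ _)
                    (add↦ (-ᶜ φ) φ (neg↦ φ p) p) (const↦ 0#))
              , (λ φ → law₁ φ (φ +ᶜ (-ᶜ φ)) (const 0#) λ p →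
                  agree (φ +ᶜ (-ᶜ φ)) (const 0#) (-‿inverseʳ _)
                    (add↦ φ (-ᶜ φ) p (neg↦ φ p)) (const↦ 0#))
            ; ⁻¹-cong = λ {φ} {φ′} → unary-cong ⊖_ negPR negPR-correct {φ} {φ′}
            }
          ; comm = λ φ ψ → law₂ φ ψ (φ +ᶜ ψ) (ψ +ᶜ φ) λ p q →
              agree (φ +ᶜ ψ) (ψ +ᶜ φ) (+-comm _ _)
                (add↦ φ ψ p q) (add↦ ψ φ q p)
          }
        ; *-cong = λ {φ} {φ′} {ψ} {ψ′} →
            binary-cong _⊗_ mulPR mulPR-correct {φ} {φ′} {ψ} {ψ′}
        ; *-assoc = λ φ ψ χ →
            law₃ φ ψ χ ((φ *ᶜ ψ) *ᶜ χ) (φ *ᶜ (ψ *ᶜ χ)) λ p q s →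
            agree ((φ *ᶜ ψ) *ᶜ χ) (φ *ᶜ (ψ *ᶜ χ)) (*-assoc _ _ _)
              (mul↦ (φ *ᶜ ψ) χ (mul↦ φ ψ p q) s)
              (mul↦ φ (ψ *ᶜ χ) p (mul↦ ψ χ q s))
        ; *-identity =
            (λ φ → law₁ φ (const 1# *ᶜ φ) φ λ p →
              agree (const 1# *ᶜ φ) φ (*-identityˡ _)
                (mul↦ (const 1#) φ (const↦ 1#) p) p)
          , (λ φ → law₁ φ (φ *ᶜ const 1#) φ λ p →
              agree (φ *ᶜ const 1#) φ (*-identityʳ _)
                (mul↦ φ (const 1#) p (const↦ 1#)) p)
        ; distrib =
            (λ φ ψ χ → law₃ φ ψ χ (φ *ᶜ (ψ +ᶜ χ)) ((φ *ᶜ ψ) +ᶜ (φ *ᶜ χ))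
              λ p q s →
              agree (φ *ᶜ (ψ +ᶜ χ)) ((φ *ᶜ ψ) +ᶜ (φ *ᶜ χ)) (distribˡ _ _ _)
                (mul↦ φ (ψ +ᶜ χ) p (add↦ ψ χ q s))
                (add↦ (φ *ᶜ ψ) (φ *ᶜ χ) (mul↦ φ ψ p q) (mul↦ φ χ p s)))
          , (λ φ ψ χ → law₃ φ ψ χ ((ψ +ᶜ χ) *ᶜ φ) ((ψ *ᶜ φ) +ᶜ (χ *ᶜ φ))
              λ p q s →
              agree ((ψ +ᶜ χ) *ᶜ φ) ((ψ *ᶜ φ) +ᶜ (χ *ᶜ φ)) (distribʳ _ _ _)
                (mul↦ (ψ +ᶜ χ) φ (add↦ ψ χ q s) p)
                (add↦ (ψ *ᶜ φ) (χ *ᶜ φ) (mul↦ ψ φ q p) (mul↦ χ φ s p)))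
        }
      ; *-comm = λ φ ψ → law₂ φ ψ (φ *ᶜ ψ) (ψ *ᶜ φ) λ p q →
          agree (φ *ᶜ ψ) (ψ *ᶜ φ) (*-comm _ _)
            (mul↦ φ ψ p q) (mul↦ ψ φ q p)
      }
    }

  -- For S ⊆ K: the classes having a representative all of whose values lie
  -- in S.
  ∏-sub : Pred Carrier 0ℓ → Pred PCF 0ℓ
  ∏-sub S φ = Σ[ ψ ∈ PCF ] φ ≋ ψ × (∀ {i x} → ψ ⟨ i ⟩↦ x → S x)

{-# OPTIONS --safe #-}
module Submission where

-- Write e₁, …, e_d for a basis of K over ℚ.  The coordinates of an element of
-- K are found by a search through ℚ^d and so are computable; hence the
-- constants e_j also span ∏K over ∏ℚ.  A field automorphism σ of K acts on ∏K by
-- φ ↦ σ ∘ φ, which is the combination of the coordinates of φ with the σ(e_j).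
-- Conversely, an automorphism of ∏K over ∏ℚ sends a constant x to a root of the
-- polynomial of x; such a root takes finitely many values almost everywhere on
-- C, so it is again a constant by cohesiveness.  Finitely many σ suffice to cut
-- out ℚ in K, so a φ fixed by all of them is rational almost everywhere on C.
-- Algebraicity is a linear dependence among 1, φ, …, φ^d.

open import Defs
open import Algebra.Bundles using (CommutativeRing)
open import Algebra.Morphism.Structures using (IsRingHomomorphism)
import Algebra.Properties.Group as GroupProperties
import Algebra.Properties.Semiring.Exp as Exp
import Algebra.Properties.Semiring.Sum as Sum
import Algebra.Solver.Ring.NaturalCoefficients.Default as Solver
open import Axiom.ExcludedMiddle using (ExcludedMiddle)
open import Data.Empty using (⊥; ⊥-elim)
open import Data.Fin.Base using (Fin; zero; suc; toℕ; punchIn)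
open import Data.List.Base using (List; []; _∷_; _++_)
open import Data.List.Relation.Unary.All as All using (All; []; _∷_)
open import Data.List.Relation.Unary.Any as Any using (Any; here; there)
open import Data.List.Relation.Unary.Any.Properties using (++⁺ˡ; ++⁺ʳ)
open import Data.Nat.Base as ℕ using (ℕ; zero; suc)
import Data.Nat.Properties as ℕ
open import Data.Product.Base using (∃-syntax; Σ-syntax; _×_; _,_; proj₁; proj₂)
open import Data.Rational.Base as ℚ using (ℚ; 0ℚ; 1ℚ)
open import Data.Sum.Base using (_⊎_; inj₁; inj₂)
open import Data.Unit.Base using (⊤; tt)
open import Data.Vec.Base as Vec using (Vec; []; _∷_; lookup)
open import Data.Vec.Functional using (Vector; head; tail; insertAt)
open import Data.Vec.Functional.Properties using (insertAt-lookup; insertAt-punchIn)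
open import Data.Vec.Relation.Binary.Pointwise.Inductive using ([]; _∷_)
open import Function.Base using (id; _∘_)
open import Function.Bundles using (mk⇔)
open import Level using (0ℓ)
open import Relation.Binary.PropositionalEquality as ≡ using (_≡_; _≢_; _≗_)
open import Relation.Nullary using (¬_; yes; no)
open import Relation.Nullary.Decidable using (decidable-stable)
open import Relation.Unary using (Pred; ∁)

-- Recursive functions

-- The presentation supplies programs only for sums, products, negation and membership in the
-- domain, whereas whatever is done to a class must be a program acting at each index. Hence
-- inverses, an enumeration of ℚ and the coordinates all come from unbounded search, and each search
-- is arranged to be total: every number stands for some element, some tuple and some rational. An
-- automorphism of K is an arbitrary function; the finitely many elements σ(e_j) are what turns it
-- into a program.
--
-- Conditions that hold almost everywhere on C can be joined only finitely often, which is why a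
-- finite list of automorphisms is extracted. The dichotomy of cohesiveness is applied to a single
-- kind of c.e. set: the indices at which a program takes one given value.
--
-- A class belongs to ∏ℚ only if some representative has rational values wherever it is defined, on
-- or off C. Operations on representatives therefore have to preserve ℚ without exception: the
-- inverse of 0 is set to 0, and `retract` projects K onto ℚ.

module RecursiveFunctions where
  open import Data.Nat.Base using (_+_; _*_; _∸_; _≤_; _<_; pred; s≤s)
  open import Data.Nat.Properties

  private variable k : ℕ

  Recursive : (Vec ℕ k → ℕ) → Set
  Recursive f = ∃[ p ] ∀ xs → p [ xs ]⇓ f xs

  Recursive₂ : (ℕ → ℕ → ℕ) → Set
  Recursive₂ _·_ = ∃[ p ] ∀ x y → p [ x ∷ y ∷ [] ]⇓ (x · y)

  Recursive₁ : (ℕ → ℕ) → Set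
  Recursive₁ f = ∃[ p ] ∀ x → p [ x ∷ [] ]⇓ f x

  rec-const : ∀ n → Recursive {k} (λ _ → n)
  rec-const n = constPR n , λ _ → ⇓const n

  rec-proj : (i : Fin k) → Recursive (λ xs → lookup xs i)
  rec-proj i = proj i , λ _ → ⇓proj

  ⇓-resp : ∀ {p : PR k} {xs x y} → x ≡ y → p [ xs ]⇓ x → p [ xs ]⇓ y
  ⇓-resp ≡.refl p⇓ = p⇓

  rec-ext : {f g : Vec ℕ k → ℕ} → f ≗ g → Recursive f → Recursive g
  rec-ext f≗g (p , p⇓) = p , λ xs → ⇓-resp (f≗g xs) (p⇓ xs)

  rec-∘₁ : ∀ {h} {f : Vec ℕ k → ℕ} → Recursive₁ h → Recursive f →
           Recursive (λ xs → h (f xs))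
  rec-∘₁ (q , q⇓) (p , p⇓) =
    comp q (p ∷ []) , λ xs → ⇓comp (p⇓ xs ∷ []) (q⇓ _)

  rec-∘₂ : ∀ {_·_} {f g : Vec ℕ k → ℕ} → Recursive₂ _·_ →
           Recursive f → Recursive g → Recursive (λ xs → f xs · g xs)
  rec-∘₂ (q , q⇓) (p , p⇓) (p′ , p′⇓) =
    comp q (p ∷ p′ ∷ []) , λ xs → ⇓comp (p⇓ xs ∷ p′⇓ xs ∷ []) (q⇓ _ _)

  unary⇒ : ∀ {h} → Recursive (λ (xs : Vec ℕ 1) → h (Vec.head xs)) → Recursive₁ h
  unary⇒ (p , p⇓) = p , λ x → p⇓ (x ∷ [])

  rec-suc : {f : Vec ℕ k → ℕ} → Recursive f → Recursive (λ xs → suc (f xs))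
  rec-suc = rec-∘₁ (suc , λ _ → ⇓suc)

  +-rec : Recursive₂ _+_
  +-rec = prec (proj zero) (comp suc (proj (suc zero) ∷ [])) , go
    where
    go : ∀ x y → _ [ x ∷ y ∷ [] ]⇓ (x + y)
    go zero    y = ⇓prec0 ⇓proj
    go (suc x) y = ⇓precS (go x y) (⇓comp (⇓proj ∷ []) ⇓suc)

  *-rec : Recursive₂ _*_
  *-rec = prec zer (comp (proj₁ +-rec) (proj (suc (suc zero)) ∷ proj (suc zero) ∷ [])) , go
    where
    go : ∀ x y → _ [ x ∷ y ∷ [] ]⇓ (x * y)
    go zero    y = ⇓prec0 ⇓zer
    go (suc x) y =
      ⇓precS (go x y) (⇓comp (⇓proj ∷ ⇓proj ∷ []) (proj₂ +-rec y (x * y)))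

  pred-rec : Recursive₁ pred
  pred-rec = prec zer (proj zero) , go
    where
    go : ∀ x → _ [ x ∷ [] ]⇓ pred x
    go zero    = ⇓prec0 ⇓zer
    go (suc x) = ⇓precS (go x) ⇓proj

  ∸-rec : Recursive₂ _∸_
  ∸-rec = comp (proj₁ flipped) (proj (suc zero) ∷ proj zero ∷ [])
        , λ x y → ⇓comp (⇓proj ∷ ⇓proj ∷ []) (proj₂ flipped y x)
    where
    -- `prec` recurses on its first argument, truncated subtraction on its second.
    flipped : Recursive₂ (λ y x → x ∸ y)
    flipped = prec (proj zero) (comp (proj₁ pred-rec) (proj (suc zero) ∷ [])) , go
      where
      go : ∀ y x → _ [ y ∷ x ∷ [] ]⇓ (x ∸ y)
      go zero    x = ⇓prec0 ⇓proj
      go (suc y) x = ⇓-resp (pred[m∸n]≡m∸[1+n] x y)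
        (⇓precS (go y x) (⇓comp (⇓proj ∷ []) (proj₂ pred-rec (x ∸ y))))

  -- Zero exactly on the diagonal, so that `mu`, which looks for zeros, can search for solutions of
  -- equations.
  dist : ℕ → ℕ → ℕ
  dist x y = (x ∸ y) + (y ∸ x)

  dist-refl : ∀ {x y} → x ≡ y → dist x y ≡ 0
  dist-refl {x} ≡.refl rewrite n∸n≡0 x = ≡.refl

  dist≡0⇒≡ : ∀ {x y} → dist x y ≡ 0 → x ≡ y
  dist≡0⇒≡ {x} {y} eq = ≤-antisym (m∸n≡0⇒m≤n (m+n≡0⇒m≡0 (x ∸ y) eq))
                                  (m∸n≡0⇒m≤n (m+n≡0⇒n≡0 (x ∸ y) eq))

  rec-dist : {f g : Vec ℕ k → ℕ} → Recursive f → Recursive g →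
             Recursive (λ xs → dist (f xs) (g xs))
  rec-dist f g = rec-∘₂ +-rec (rec-∘₂ ∸-rec f g) (rec-∘₂ ∸-rec g f)

  dist-rec : Recursive₂ dist
  dist-rec with p , p⇓ ← rec-dist (rec-proj zero) (rec-proj {2} (suc zero)) =
    p , λ x y → p⇓ (x ∷ y ∷ [])

  least-zero : ∀ (f : ℕ → ℕ) n → f n ≡ 0 →
               ∃[ m ] f m ≡ 0 × (∀ {k} → k < m → ∃[ v ] f k ≡ suc v)
  least-zero f n fn≡0 with f 0 in eq
  least-zero f n       fn≡0 | zero  = 0 , eq , λ ()
  least-zero f zero    fn≡0 | suc v with () ← ≡.trans (≡.sym eq) fn≡0
  least-zero f (suc n) fn≡0 | suc v with m , fm , below ← least-zero (f ∘ suc) n fn≡0 =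
    suc m , fm , λ { {zero} _ → v , eq ; {suc k} (s≤s k<m) → below k<m }

  opaque
    -- `⇓mu` demands a positive value of the body at every smaller argument, so the given zero is
    -- first cut down to the least one. Minimality stays in the conclusion because it pins down the
    -- integer square root below.
    rec-search : {R : Vec ℕ (suc k) → ℕ} → Recursive R →
                 (∀ xs → ∃[ n ] R (n ∷ xs) ≡ 0) →
                 Σ[ s ∈ (Vec ℕ k → ℕ) ] Recursive s ×
                   (∀ xs → R (s xs ∷ xs) ≡ 0 ×
                           (∀ {n} → n < s xs → ∃[ v ] R (n ∷ xs) ≡ suc v))
    rec-search {k = k} {R = R} (p , p⇓) total = (λ xs → proj₁ (least xs)) , (mu p , halts) , λ xs → proj₂ (least xs)
      where
      least : (xs : Vec ℕ k) → ∃[ m ] R (m ∷ xs) ≡ 0 × (∀ {n} → n < m → ∃[ v ] R (n ∷ xs) ≡ suc v)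
      least xs = least-zero (λ n → R (n ∷ xs)) _ (proj₂ (total xs))
      halts : ∀ xs → mu p [ xs ]⇓ proj₁ (least xs)
      halts xs with _ , hit , below ← least xs =
        ⇓mu (⇓-resp hit (p⇓ _)) λ m<n → let v , eq = below m<n in v , ⇓-resp eq (p⇓ _)

  -- The pair (a , b) is coded by (a + b)² + a, whose integer square root is
  -- a + b because a ≤ 2 (a + b).
  module Pairing where

    -- Zero exactly when m < (s + 1)²; the least such s is the integer square root of m.
    overshoot : ℕ → ℕ → ℕ
    overshoot s m = suc m ∸ suc s * suc s

    overshoot-rec : Recursive {2} (λ xs → overshoot (Vec.head xs) (Vec.head (Vec.tail xs)))
    overshoot-rec = rec-ext (λ { (_ ∷ _ ∷ []) → ≡.refl })
      (rec-∘₂ ∸-rec (rec-suc (rec-proj (suc zero)))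
        (rec-∘₂ *-rec (rec-suc (rec-proj zero)) (rec-suc (rec-proj zero))))

    search = rec-search overshoot-rec λ { (m ∷ []) → m , m≤n⇒m∸n≡0 (m≤m+n (suc m) (m * suc m)) }

    sqrt : ℕ → ℕ
    sqrt m = proj₁ search (m ∷ [])

    sqrt-rec : Recursive₁ sqrt
    sqrt-rec with p , p⇓ ← proj₁ (proj₂ search) = p , λ m → p⇓ (m ∷ [])

    least-unique : ∀ (f : ℕ → ℕ) {m n} → f m ≡ 0 → (∀ {k} → k < m → ∃[ v ] f k ≡ suc v) →
                   f n ≡ 0 → (∀ {k} → k < n → ∃[ v ] f k ≡ suc v) → m ≡ n
    least-unique f {m} {n} fm m-least fn n-least = ≤-antisym
      (≮⇒≥ λ n<m → absurd fn (proj₂ (m-least n<m)))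
      (≮⇒≥ λ m<n → absurd fm (proj₂ (n-least m<n)))
      where
      absurd : ∀ {A : Set} {x v} → x ≡ 0 → x ≡ suc v → A
      absurd ≡.refl ()

    pair : ℕ → ℕ → ℕ
    pair a b = (a + b) * (a + b) + a

    sqrt-pair : ∀ a b → sqrt (pair a b) ≡ a + b
    sqrt-pair a b =
      let hit , below = proj₂ (proj₂ search) (pair a b ∷ []) in
      least-unique (λ s → overshoot s (pair a b)) hit below
           (m≤n⇒m∸n≡0 (s≤s bound)) positive
      where
      bound : pair a b ≤ a + b + (a + b) * suc (a + b)
      bound = begin
        (a + b) * (a + b) + a               ≤⟨ +-mono-≤ (*-monoʳ-≤ (a + b) (n≤1+n (a + b))) (m≤m+n a b) ⟩
        (a + b) * suc (a + b) + (a + b)     ≡⟨ +-comm _ (a + b) ⟩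
        a + b + (a + b) * suc (a + b)       ∎
        where open ≤-Reasoning
      positive : ∀ {k} → k < a + b → ∃[ v ] overshoot k (pair a b) ≡ suc v
      positive {k} k<s = pair a b ∸ suc k * suc k ,
        +-∸-assoc 1 (≤-trans (*-mono-≤ k<s k<s) (m≤m+n ((a + b) * (a + b)) a))

    opaque
      left right : ℕ → ℕ
      left  m = m ∸ sqrt m * sqrt m
      right m = sqrt m ∸ left m

      rec-left : {f : Vec ℕ k → ℕ} → Recursive f → Recursive (λ xs → left (f xs))
      rec-left f = rec-∘₂ ∸-rec f (rec-∘₂ *-rec (rec-∘₁ sqrt-rec f) (rec-∘₁ sqrt-rec f))

      rec-right : {f : Vec ℕ k → ℕ} → Recursive f → Recursive (λ xs → right (f xs))
      rec-right f = rec-∘₂ ∸-rec (rec-∘₁ sqrt-rec f) (rec-left f)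

      left-pair : ∀ a b → left (pair a b) ≡ a
      left-pair a b rewrite sqrt-pair a b = m+n∸m≡n ((a + b) * (a + b)) a

      right-pair : ∀ a b → right (pair a b) ≡ b
      right-pair a b rewrite left-pair a b | sqrt-pair a b = m+n∸m≡n a b

    -- Pairs are nested to the right, and every number is read as a tuple of any length, so a search
    -- through tuples never meets an invalid code.
    component : ∀ {n} → Fin n → ℕ → ℕ
    component zero    m = left m
    component (suc j) m = component j (right m)

    rec-component : ∀ {n} (j : Fin n) {f : Vec ℕ k → ℕ} → Recursive f →
                    Recursive (λ xs → component j (f xs))
    rec-component zero    f = rec-left f
    rec-component (suc j) f = rec-component j (rec-right f)

    tuple : ∀ {n} → (Fin n → ℕ) → ℕ
    tuple {zero}  v = 0
    tuple {suc n} v = pair (v zero) (tuple (v ∘ suc))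

    component-tuple : ∀ {n} (v : Fin n → ℕ) j → component j (tuple v) ≡ v j
    component-tuple v zero    = left-pair (v zero) _
    component-tuple v (suc j) = ≡.trans
      (≡.cong (component j) (right-pair (v zero) _)) (component-tuple (v ∘ suc) j)

open RecursiveFunctions

-- Linear algebra and polynomials

module Summation (L : CommutativeRing 0ℓ 0ℓ) where
  open CommutativeRing L hiding (zero)
  open Sum semiring public using (sum; *-distribˡ-sum; *-distribʳ-sum; sum-remove; ∑-distrib-+; ∑-comm)
    renaming (sum-cong-≋ to sum-cong)
  open Exp semiring public using (_^_)
  open Solver commutativeSemiring public using (solve; _:=_; _:+_; _:*_)
  open import Relation.Binary.Reasoning.Setoid setoid

  sum-zero : ∀ {n} {t : Vector Carrier n} → (∀ j → t j ≈ 0#) → sum t ≈ 0#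
  sum-zero {zero}  t≈0 = refl
  sum-zero {suc n} t≈0 = trans (+-cong (t≈0 zero) (sum-zero (t≈0 ∘ suc))) (+-identityˡ 0#)

  -- Horner's form of the power sum in `IsAlgebraic`. It turns division by a linear factor and the
  -- action of an automorphism into structural recursions.
  eval : ∀ {n} → Vector Carrier n → Carrier → Carrier
  eval {zero}  a x = 0#
  eval {suc n} a x = head a + x * eval (tail a) x

  sum≈eval : ∀ {n} (a : Vector Carrier n) x → sum (λ j → a j * x ^ toℕ j) ≈ eval a x
  sum≈eval {zero}  a x = refl
  sum≈eval {suc n} a x = +-cong (*-identityʳ _) (begin
    sum (λ j → a (suc j) * (x * x ^ toℕ j)) ≈⟨ sum-cong (λ j →
      solve 3 (λ a x y → (a :* (x :* y)) := (x :* (a :* y))) refl (a (suc j)) x (x ^ toℕ j)) ⟩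
    sum (λ j → x * (a (suc j) * x ^ toℕ j)) ≈⟨ *-distribˡ-sum x (λ j → a (suc j) * x ^ toℕ j) ⟨
    x * sum (λ j → a (suc j) * x ^ toℕ j)   ≈⟨ *-congˡ (sum≈eval (tail a) x) ⟩
    x * eval (tail a) x                     ∎)

  -- Synthetic division by X − r of the polynomial with coefficients a.
  quotient : ∀ {n} → Vector Carrier (suc n) → Carrier → Vector Carrier n
  quotient {suc n} a r zero    = eval (tail a) r
  quotient {suc n} a r (suc j) = quotient (tail a) r j

  factor : ∀ {n} (a : Vector Carrier (suc n)) r y →
           eval a y ≈ eval a r + (y - r) * eval (quotient a r) y
  factor {zero} a r y = begin
    a zero + y * 0#                      ≈⟨ +-congˡ (trans (zeroʳ y) (sym (zeroʳ r))) ⟩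
    a zero + r * 0#                      ≈⟨ +-identityʳ _ ⟨
    a zero + r * 0# + 0#                 ≈⟨ +-congˡ (zeroʳ (y - r)) ⟨
    a zero + r * 0# + (y - r) * 0#       ∎
  factor {suc n} a r y = begin
    a zero + y * eval (tail a) y         ≈⟨ +-congˡ (*-congˡ (factor (tail a) r y)) ⟩
    a zero + y * (p + t * q)             ≈⟨ +-congˡ (distribˡ y p (t * q)) ⟩
    -- Only the y in front of p is split as r + t: the part r p completes the Horner value at r, and
    -- t p supplies the constant term of the quotient.
    a zero + (y * p + y * (t * q))       ≈⟨ +-congˡ (+-congʳ (*-congʳ (sym r+t≈y))) ⟩
    a zero + ((r + t) * p + y * (t * q)) ≈⟨ solve 6 (λ c r t p y q →
      (c :+ ((r :+ t) :* p :+ y :* (t :* q))) := ((c :+ r :* p) :+ t :* (p :+ y :* q))) refl (a zero) r t p y q ⟩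
    a zero + r * p + t * (p + y * q)     ∎
    where
    t = y - r
    p = eval (tail a) r
    q = eval (quotient (tail a) r) y
    r+t≈y : r + t ≈ y
    r+t≈y = trans (+-comm r t) (trans (+-assoc y (- r) r)
              (trans (+-congˡ (-‿inverseˡ r)) (+-identityʳ y)))

  -- The coefficients satisfy q_j = a_{j+1} + r q_{j+1}, where the term beyond the top coefficient
  -- is 0.
  quotient-zero : ∀ {n} (a : Vector Carrier (suc n)) r → (∀ j → quotient a r j ≈ 0#) →
                  ∀ j → a (suc j) ≈ 0#
  quotient-zero {suc n} a r q≈0 (suc j) = quotient-zero (tail a) r (q≈0 ∘ suc) j
  quotient-zero {suc n} a r q≈0 zero    = begin
    a (suc zero)           ≈⟨ +-identityʳ _ ⟨
    a (suc zero) + 0#      ≈⟨ +-congˡ (trans (*-congˡ (rest n a q≈0)) (zeroʳ r)) ⟨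
    eval (tail a) r        ≈⟨ q≈0 zero ⟩
    0#                     ∎
    where
    rest : ∀ n (a : Vector Carrier (suc (suc n))) → (∀ j → quotient a r j ≈ 0#) → eval (tail (tail a)) r ≈ 0#
    rest zero    a q≈0 = refl
    rest (suc n) a q≈0 = q≈0 (suc zero)

  -- Associativity of row times matrix times column: a relation between coordinate vectors becomes a
  -- relation between the elements they describe.
  sum-swap : ∀ {m n} (c : Vector Carrier m) (v : Fin m → Vector Carrier n) (e : Vector Carrier n) →
    sum (λ i → c i * sum (λ j → v i j * e j)) ≈ sum (λ j → sum (λ i → c i * v i j) * e j)
  sum-swap c v e = begin
    sum (λ i → c i * sum (λ j → v i j * e j))
      ≈⟨ sum-cong (λ i → trans (*-distribˡ-sum (c i) (λ j → v i j * e j))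
                               (sum-cong λ j → sym (*-assoc (c i) (v i j) (e j)))) ⟩
    sum (λ i → sum (λ j → c i * v i j * e j))
      ≈⟨ ∑-comm (λ i j → c i * v i j * e j) ⟩
    sum (λ j → sum (λ i → c i * v i j * e j))
      ≈⟨ sum-cong (λ j → sym (*-distribʳ-sum (e j) (λ i → c i * v i j))) ⟩
    sum (λ j → sum (λ i → c i * v i j) * e j) ∎

module FieldTheory (em : ExcludedMiddle 0ℓ) (L : CommutativeRing 0ℓ 0ℓ) (isField : IsField L) where
  open CommutativeRing L hiding (zero)
  open Summation L
  open IsField isField
  open GroupProperties +-group using (x∙y⁻¹≈ε⇒x≈y)
  open import Relation.Binary.Reasoning.Setoid setoid

  nonzero-cancel : ∀ {x y} → ¬ x ≈ 0# → x * y ≈ 0# → y ≈ 0#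
  nonzero-cancel {x} {y} x≉0 xy≈0 = let x⁻¹ , xx⁻¹≈1 = inverses x x≉0 in begin
    y              ≈⟨ *-identityˡ y ⟨
    1# * y         ≈⟨ *-congʳ xx⁻¹≈1 ⟨
    x * x⁻¹ * y    ≈⟨ solve 3 (λ x i y → (x :* i :* y) := (i :* (x :* y))) refl x x⁻¹ y ⟩
    x⁻¹ * (x * y)  ≈⟨ *-congˡ xy≈0 ⟩
    x⁻¹ * 0#       ≈⟨ zeroʳ x⁻¹ ⟩
    0#             ∎

  nonzero-cancelˡ : ∀ {x y z} → ¬ x ≈ 0# → x * y ≈ x * z → y ≈ z
  nonzero-cancelˡ {x} {y} {z} x≉0 xy≈xz = x∙y⁻¹≈ε⇒x≈y y z (nonzero-cancel x≉0 (begin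
    x * (y - z)      ≈⟨ distribˡ x y (- z) ⟩
    x * y + x * - z  ≈⟨ +-congʳ xy≈xz ⟩
    x * z + x * - z  ≈⟨ distribˡ x z (- z) ⟨
    x * (z - z)      ≈⟨ *-congˡ (-‿inverseʳ z) ⟩
    x * 0#           ≈⟨ zeroʳ x ⟩
    0#               ∎))

  -- Induction on the number of coefficients: a root y ≠ r is a root of the quotient by X - r. If
  -- that quotient were zero, the polynomial would be a constant vanishing at r, hence zero itself.
  finitely-many-roots : ∀ {n} (a : Vector Carrier n) → (∃[ j ] ¬ a j ≈ 0#) →
    Σ[ rs ∈ List Carrier ] (∀ y → eval a y ≈ 0# → Any (y ≈_) rs)
  finitely-many-roots {suc n} a a≉0 with em {∃[ r ] eval a r ≈ 0#}
  ... | no ¬root = [] , λ y root → ⊥-elim (¬root (y , root))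
  ... | yes (r , ar≈0) with em {∃[ j ] ¬ quotient a r j ≈ 0#}
  ...   | yes q≉0 =
    let rs , complete = finitely-many-roots (quotient a r) q≉0 in
    r ∷ rs , λ y root → case y root complete
    where
    case : ∀ y → eval a y ≈ 0# → ∀ {rs} → (∀ y → eval (quotient a r) y ≈ 0# → Any (y ≈_) rs) → Any (y ≈_) (r ∷ rs)
    case y root complete with em {y ≈ r}
    ... | yes y≈r = here y≈r
    ... | no  y≉r = there (complete y (nonzero-cancel (λ d → y≉r (x∙y⁻¹≈ε⇒x≈y _ _ d)) (begin
      (y - r) * eval (quotient a r) y             ≈⟨ +-identityˡ _ ⟨
      0# + (y - r) * eval (quotient a r) y        ≈⟨ +-congʳ ar≈0 ⟨
      eval a r + (y - r) * eval (quotient a r) y  ≈⟨ factor a r y ⟨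
      eval a y                                    ≈⟨ root ⟩
      0#                                          ∎)))
  ...   | no q≈0 = ⊥-elim (proj₂ a≉0 (all-zero (proj₁ a≉0)))
    where
    tail-zero : ∀ j → a (suc j) ≈ 0#
    tail-zero = quotient-zero a r λ j → decidable-stable em λ q≉0 → q≈0 (j , q≉0)
    eval-zero : ∀ {n} (b : Vector Carrier n) → (∀ j → b j ≈ 0#) → eval b r ≈ 0#
    eval-zero {zero}  b b≈0 = refl
    eval-zero {suc n} b b≈0 = trans (+-cong (b≈0 zero)
      (trans (*-congˡ (eval-zero (tail b) (b≈0 ∘ suc))) (zeroʳ r))) (+-identityˡ 0#)
    all-zero : ∀ j → a j ≈ 0#
    all-zero (suc j) = tail-zero j
    all-zero zero    = begin
      a zero                     ≈⟨ +-identityʳ _ ⟨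
      a zero + 0#                ≈⟨ +-congˡ (trans (*-congˡ (eval-zero (tail a) tail-zero)) (zeroʳ r)) ⟨
      eval a r                   ≈⟨ ar≈0 ⟩
      0#                         ∎

  module _ {F : Pred Carrier 0ℓ} (F-subfield : IsSubfield L F) where
    open IsSubfield F-subfield

    sum-closed : ∀ {n} {t : Vector Carrier n} → (∀ j → F (t j)) → F (sum t)
    sum-closed {zero}  t∈F = 0∈
    sum-closed {suc n} t∈F = +-closed (t∈F zero) (sum-closed (t∈F ∘ suc))

    -- Elimination along the first column. It is done without division, so the coefficients remain
    -- in `F` by closure under ring operations.
    linearly-dependent : ∀ n (v : Fin (suc n) → Vector Carrier n) → (∀ i j → F (v i j)) →
      Σ[ c ∈ Vector Carrier (suc n) ] (∀ i → F (c i)) × (∃[ i ] ¬ c i ≈ 0#) ×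
        (∀ j → sum (λ i → c i * v i j) ≈ 0#)
    linearly-dependent zero v v∈F = (λ _ → 1#) , (λ _ → 1∈) , (zero , λ 1≈0 → 0≉1 (sym 1≈0)) , λ ()
    linearly-dependent (suc n) v v∈F with em {∃[ p ] ¬ v p zero ≈ 0#}
    ... | no column≈0 =
      -- The column vanishes, so the vectors live in one dimension less, and one of them can be left
      -- out with coefficient 0.
      let c , c∈F , (i , ci≉0) , dep = linearly-dependent n (λ i → tail (v (suc i))) (λ i j → v∈F (suc i) (suc j))
          col = λ p → decidable-stable em λ vp≉0 → column≈0 (p , vp≉0)
      in insertAt c zero 0# , (λ { zero → 0∈ ; (suc i) → c∈F i }) , (suc i , ci≉0) ,
         λ { zero    → sum-zero λ p → trans (*-congˡ (col p)) (zeroʳ (insertAt c zero 0# p))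
           ; (suc j) → trans (+-cong (zeroˡ _) (dep j)) (+-identityˡ 0#) }
    ... | yes (p , pivot≉0) =
      insertAt c′ p cₚ , c∈F , (punchIn p (proj₁ d≉0) , c≉0) , dependence
      where
      u : Fin (suc n) → Vector Carrier (suc n)
      u = v ∘ punchIn p
      -- The combination with the pivot vector that kills column zero; the induction runs on the
      -- remaining columns.
      w : Fin (suc n) → Vector Carrier (suc n)
      w i j = v p zero * u i j + (- u i zero) * v p j
      IH = linearly-dependent n (λ i → tail (w i)) λ i j →
        +-closed (*-closed (v∈F _ _) (v∈F _ _)) (*-closed (neg-closed (v∈F _ _)) (v∈F _ _))
      d   = proj₁ IH
      d∈F = proj₁ (proj₂ IH)
      d≉0 = proj₁ (proj₂ (proj₂ IH))
      -- The total multiple of the pivot vector that appears when the relation between the `w i` is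
      -- expanded.
      cₚ : Carrier
      cₚ = sum (λ i → d i * - u i zero)
      c′ : Vector Carrier (suc n)
      c′ i = v p zero * d i
      c≉0 : ¬ insertAt c′ p cₚ (punchIn p (proj₁ d≉0)) ≈ 0#
      c≉0 c≈0 = proj₂ d≉0 (nonzero-cancel pivot≉0
        (trans (reflexive (≡.sym (insertAt-punchIn c′ p cₚ _))) c≈0))
      c∈F : ∀ i → F (insertAt c′ p cₚ i)
      c∈F = insert-closed p c′ (λ i → *-closed (v∈F p zero) (d∈F i))
              (sum-closed λ i → *-closed (d∈F i) (neg-closed (v∈F (punchIn p i) zero)))
        where
        insert-closed : ∀ {n} (p : Fin (suc n)) (c : Vector Carrier n) {x} → (∀ i → F (c i)) → F x →
                        ∀ i → F (insertAt c p x i)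
        insert-closed zero c c∈F x∈F zero    = x∈F
        insert-closed zero c c∈F x∈F (suc i) = c∈F i
        insert-closed {suc _} (suc p) c c∈F x∈F zero    = c∈F zero
        insert-closed {suc _} (suc p) c c∈F x∈F (suc i) = insert-closed p (c ∘ suc) (c∈F ∘ suc) x∈F i
      w-dep : ∀ j → sum (λ i → d i * w i j) ≈ 0#
      w-dep (suc j) = proj₂ (proj₂ (proj₂ IH)) j
      w-dep zero    = sum-zero λ i → trans (*-congˡ (begin
        v p zero * u i zero + (- u i zero) * v p zero ≈⟨ +-congʳ (*-comm _ _) ⟩
        u i zero * v p zero + (- u i zero) * v p zero ≈⟨ distribʳ _ _ _ ⟨
        (u i zero - u i zero) * v p zero              ≈⟨ *-congʳ (-‿inverseʳ _) ⟩
        0# * v p zero                                 ≈⟨ zeroˡ _ ⟩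
        0#                                            ∎)) (zeroʳ (d i))
      dependence : ∀ j → sum (λ i → insertAt c′ p cₚ i * v i j) ≈ 0#
      dependence j = begin
        sum (λ i → c i * v i j)
          ≈⟨ sum-remove {i = p} (λ i → c i * v i j) ⟩
        c p * v p j + sum (λ i → c (punchIn p i) * u i j)
          ≈⟨ +-cong (*-congʳ (reflexive (insertAt-lookup c′ p cₚ)))
                    (sum-cong λ i → *-congʳ {u i j} (reflexive (insertAt-punchIn c′ p cₚ i))) ⟩
        cₚ * v p j + sum (λ i → c′ i * u i j)
          ≈⟨ +-congʳ (*-distribʳ-sum (v p j) (λ i → d i * - u i zero)) ⟩
        sum (λ i → d i * - u i zero * v p j) + sum (λ i → c′ i * u i j)
          ≈⟨ ∑-distrib-+ (λ i → d i * - u i zero * v p j) (λ i → c′ i * u i j) ⟨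
        sum (λ i → d i * - u i zero * v p j + c′ i * u i j)
          ≈⟨ sum-cong (λ i → solve 5 (λ d m b a u → (d :* m :* b :+ a :* d :* u) := (d :* (a :* u :+ m :* b)))
               refl (d i) (- u i zero) (v p j) (v p zero) (u i j)) ⟩
        sum (λ i → d i * w i j)
          ≈⟨ w-dep j ⟩
        0# ∎
        where c = insertAt c′ p cₚ

-- Automorphisms and conjugate elements

module Automorphisms {L : CommutativeRing 0ℓ 0ℓ} {F : Pred (CommutativeRing.Carrier L) 0ℓ} where
  open CommutativeRing L hiding (zero)
  open Summation L

  module _ (σ : Aut L F) where
    open Aut σ

    to-sum : ∀ {n} (t : Vector Carrier n) → to (sum t) ≈ sum (to ∘ t)
    to-sum {zero}  t = 0#-homo
    to-sum {suc n} t = trans (+-homo _ _) (+-congˡ (to-sum (tail t)))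

    to-combination : ∀ {n} (c e : Vector Carrier n) → (∀ j → F (c j)) →
                     to (sum (λ j → c j * e j)) ≈ sum (λ j → c j * to (e j))
    to-combination c e c∈F = trans (to-sum (λ j → c j * e j))
      (sum-cong λ j → trans (*-homo (c j) (e j)) (*-congʳ (fixes (c∈F j))))

    to-eval : ∀ {n} (a : Vector Carrier n) x → (∀ j → F (a j)) → to (eval a x) ≈ eval a (to x)
    to-eval {zero}  a x a∈F = 0#-homo
    to-eval {suc n} a x a∈F = trans (+-homo _ _) (+-cong (fixes (a∈F zero))
      (trans (*-homo _ _) (*-congˡ (to-eval (tail a) x (a∈F ∘ suc)))))

    to-root : ∀ {n} (a : Vector Carrier n) {x} → (∀ j → F (a j)) → eval a x ≈ 0# → eval a (to x) ≈ 0#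
    to-root a {x} a∈F root = trans (sym (to-eval a x a∈F)) (trans (⟦⟧-cong root) 0#-homo)

  module _ (em : ExcludedMiddle 0ℓ) (isField : IsField L) (algebraic : ∀ x → IsAlgebraic L F x) where
    open FieldTheory em L isField

    conjugates : ∀ x → Σ[ rs ∈ List Carrier ] (∀ σ → Any (Aut.to {L} {F} σ x ≈_) rs)
    conjugates x with n , a , a∈F , a≉0 , root ← algebraic x
                 with rs , complete ← finitely-many-roots a a≉0 =
      rs , λ σ → complete (Aut.to σ x) (to-root σ a a∈F (trans (sym (sum≈eval a x)) root))

    -- `Q` accumulates the values prescribed on the elements already treated; the next element has
    -- only finitely many `conjugates` as possible images. At the end excluded middle picks one
    -- automorphism for each system of values that occurs.
    finitely-many-restrictions : ∀ {n} (e : Vector Carrier n) (Q : Aut L F → Set) →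
      Σ[ τs ∈ List (Aut L F) ] (∀ σ → Q σ → Any (λ τ → Q τ × (∀ j → Aut.to τ (e j) ≈ Aut.to σ (e j))) τs)
    finitely-many-restrictions {zero} e Q with em {∃[ σ ] Q σ}
    ... | yes (τ , Qτ) = τ ∷ [] , λ σ Qσ → here (Qτ , λ ())
    ... | no  none     = [] , λ σ Qσ → ⊥-elim (none (σ , Qσ))
    finitely-many-restrictions {suc n} e Q =
      let rs , complete = conjugates (e zero)
          τs , found    = over rs
      in τs , λ σ Qσ → found σ Qσ (complete σ)
      where
      over : ∀ rs → Σ[ τs ∈ List (Aut L F) ] (∀ σ → Q σ → Any (Aut.to σ (e zero) ≈_) rs →
               Any (λ τ → Q τ × (∀ j → Aut.to τ (e j) ≈ Aut.to σ (e j))) τs)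
      over []       = [] , λ _ _ ()
      over (r ∷ rs) =
        let τs  , found  = finitely-many-restrictions (tail e) (λ σ → Q σ × Aut.to σ (e zero) ≈ r)
            τs′ , found′ = over rs
        in τs ++ τs′ , λ where
          σ Qσ (here σe≈r) → ++⁺ˡ (Any.map
            (λ { ((Qτ , τe≈r) , agree) → Qτ , λ { zero → trans τe≈r (sym σe≈r) ; (suc j) → agree j } })
            (found σ (Qσ , σe≈r)))
          σ Qσ (there σe∈rs) → ++⁺ʳ τs (found′ σ Qσ σe∈rs)

-- Computability in a number field

module RationalArithmetic where
  open import Data.Integer.Base as ℤ using (ℤ; +_; -[1+_])
  import Data.Integer.Properties as ℤ
  open import Data.Integer.Tactic.RingSolver using (solve-∀)
  open import Data.Rational.Base using (mkℚ; toℚᵘ)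
  import Data.Rational.Properties as ℚ
  open import Data.Rational.Unnormalised.Base as ℚᵘ using (mkℚᵘ; _≃_; *≡*)
  import Data.Rational.Unnormalised.Properties as ℚᵘ

  -- Built by repeatedly adding 1, so that `ι` carries it to `natural` by the homomorphism laws
  -- alone.
  natℚ : ℕ → ℚ
  natℚ zero    = 0ℚ
  natℚ (suc n) = 1ℚ ℚ.+ natℚ n

  toℚᵘ-natℚ : ∀ n → toℚᵘ (natℚ n) ≃ mkℚᵘ (+ n) 0
  toℚᵘ-natℚ zero    = ℚᵘ.≃-refl
  toℚᵘ-natℚ (suc n) = ℚᵘ.≃-trans (ℚ.toℚᵘ-homo-+ 1ℚ (natℚ n))
    (ℚᵘ.≃-trans (ℚᵘ.+-congʳ ℚᵘ.1ℚᵘ (toℚᵘ-natℚ n)) (*≡* (lemma (+ n))))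
    where
    lemma : ∀ (m : ℤ) → (+ 1 ℤ.* + 1 ℤ.+ m ℤ.* + 1) ℤ.* + 1 ≡ (+ 1 ℤ.+ m) ℤ.* + 1
    lemma = solve-∀

  difference : ∀ (m : ℤ) → ∃[ a ] ∃[ b ] m ℤ.+ + b ≡ + a
  difference (+ a)    = a , 0 , ℤ.+-identityʳ (+ a)
  difference -[1+ b ] = 0 , suc b , ℤ.+-inverseˡ (+ suc b)

  -- This is q = (a - b) / (c + 1) with subtraction and division cleared, so that `ι` transports it
  -- through sums and products. The field c of `mkℚ` is already the denominator less one.
  fraction : ∀ q → ∃[ a ] ∃[ b ] ∃[ c ] q ℚ.* natℚ (suc c) ℚ.+ natℚ b ≡ natℚ a
  fraction q@(mkℚ num c _) with a , b , eq ← difference num = a , b , c , ℚ.toℚᵘ-injective (begin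
    toℚᵘ (q ℚ.* natℚ (suc c) ℚ.+ natℚ b)
      ≈⟨ ℚ.toℚᵘ-homo-+ (q ℚ.* natℚ (suc c)) (natℚ b) ⟩
    toℚᵘ (q ℚ.* natℚ (suc c)) ℚᵘ.+ toℚᵘ (natℚ b)
      ≈⟨ ℚᵘ.+-cong (ℚᵘ.≃-trans (ℚ.toℚᵘ-homo-* q (natℚ (suc c))) (ℚᵘ.*-congˡ {toℚᵘ q} (toℚᵘ-natℚ (suc c))))
                   (toℚᵘ-natℚ b) ⟩
    toℚᵘ q ℚᵘ.* mkℚᵘ (+ suc c) 0 ℚᵘ.+ mkℚᵘ (+ b) 0
      ≈⟨ *≡* (≡.trans (lemma num (+ b) (+ suc (c ℕ.* 1)) (+ suc c) (≡.cong (λ k → + suc k) (ℕ.*-identityʳ c)))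
             (≡.cong (ℤ._* (+ suc (c ℕ.* 1) ℤ.* + 1)) eq)) ⟩
    mkℚᵘ (+ a) 0
      ≈⟨ toℚᵘ-natℚ a ⟨
    toℚᵘ (natℚ a)
      ∎)
    where
    open import Relation.Binary.Reasoning.Setoid ℚᵘ.≃-setoid
    lemma : ∀ (m b d d′ : ℤ) → d ≡ d′ → ((m ℤ.* d′) ℤ.* + 1 ℤ.+ b ℤ.* d) ℤ.* + 1 ≡ (m ℤ.+ b) ℤ.* (d ℤ.* + 1)
    lemma m b d _ ≡.refl = solve m b d
      where
      solve : ∀ (m b d : ℤ) → ((m ℤ.* d) ℤ.* + 1 ℤ.+ b ℤ.* d) ℤ.* + 1 ≡ (m ℤ.+ b) ℤ.* (d ℤ.* + 1)
      solve = solve-∀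

  natℚ-invertible : ∀ n → ∃[ r ] natℚ (suc n) ℚ.* r ≡ 1ℚ
  natℚ-invertible n = invert (natℚ (suc n)) λ eq →
    absurd (ℚᵘ.≃-trans (ℚᵘ.≃-sym (toℚᵘ-natℚ (suc n))) (ℚ.toℚᵘ-cong eq))
    where
    absurd : ¬ mkℚᵘ (+ suc n) 0 ≃ mkℚᵘ (+ 0) 0
    absurd (*≡* ())
    invert : ∀ q → q ≢ 0ℚ → ∃[ r ] q ℚ.* r ≡ 1ℚ
    invert q q≢0 = (ℚ.1/ q) {{ℚ.≢-nonZero q≢0}} , ℚ.*-inverseʳ q {{ℚ.≢-nonZero q≢0}}

open RationalArithmetic

-- Computable functions on a presented ring

module PresentedRing (em : ExcludedMiddle 0ℓ) {K : CommutativeRing 0ℓ 0ℓ} (P : ComputablePresentation K) where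
  open CommutativeRing K hiding (zero)
  open ComputablePresentation P
  open Summation K

  -- Numbers that code nothing stand for 0, so that every number is an admissible candidate in a
  -- search.
  decode : ℕ → Carrier
  decode n with em {Domain n}
  ... | yes (x , _) = x
  ... | no  _       = 0#

  decode-code : ∀ x → decode (code x) ≈ x
  decode-code x with em {Domain (code x)}
  ... | yes (y , eq) = code-injective eq
  ... | no  undef    = ⊥-elim (undef (x , ≡.refl))

  -- The case distinction is the arithmetic expression χ(n) n + (1 - χ(n)) code 0, where χ is the
  -- characteristic function of the computable domain.
  code-decode-rec : Recursive₁ (code ∘ decode)
  code-decode-rec = unary⇒ (rec-ext (λ { (n ∷ []) → agrees n })
    (rec-∘₂ +-rec
      (rec-∘₂ *-rec χ-rec (rec-proj zero))
      (rec-∘₂ *-rec (rec-∘₂ ∸-rec (rec-const 1) χ-rec) (rec-const (code 0#)))))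
    where
    χ : ℕ → ℕ
    χ n with em {Domain n}
    ... | yes _ = 1
    ... | no  _ = 0
    χ-halts : ∀ n → proj₁ domain-computable [ n ∷ [] ]⇓ χ n
    χ-halts n with em {Domain n}
    ... | yes n∈D = proj₁ (proj₂ domain-computable n) n∈D
    ... | no  n∉D = proj₂ (proj₂ domain-computable n) n∉D
    χ-rec : Recursive {1} (λ xs → χ (Vec.head xs))
    χ-rec = proj₁ domain-computable , λ { (n ∷ []) → χ-halts n }
    agrees : ∀ n → χ n ℕ.* n ℕ.+ (1 ℕ.∸ χ n) ℕ.* code 0# ≡ code (decode n)
    agrees n with em {Domain n}
    ... | yes (x , eq) = ≡.trans (ℕ.+-identityʳ _) (≡.trans (ℕ.*-identityˡ n) (≡.sym eq))
    ... | no  _        = ℕ.+-identityʳ (code 0#)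

  RecursiveK : ∀ {k} → (Vec ℕ k → Carrier) → Set
  RecursiveK f = Recursive (λ xs → code (f xs))

  -- As for the operations of the presentation, the program is left free on numbers that are not
  -- codes.
  Effective : (Carrier → Carrier) → Set
  Effective h = ∃[ p ] ∀ x → p [ code x ∷ [] ]⇓ code (h x)

  module _ {k : ℕ} where

    recK-const : ∀ x → RecursiveK {k} (λ _ → x)
    recK-const x = rec-const (code x)

    recK-decode : {f : Vec ℕ k → ℕ} → Recursive f → RecursiveK (λ xs → decode (f xs))
    recK-decode = rec-∘₁ code-decode-rec

    recK-∘ : ∀ {h} {f : Vec ℕ k → Carrier} → Effective h → RecursiveK f → RecursiveK (λ xs → h (f xs))
    recK-∘ (q , q⇓) (p , p⇓) = comp q (p ∷ []) , λ xs → ⇓comp (p⇓ xs ∷ []) (q⇓ _)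

    recK-+ : {f g : Vec ℕ k → Carrier} → RecursiveK f → RecursiveK g → RecursiveK (λ xs → f xs + g xs)
    recK-+ (p , p⇓) (q , q⇓) = comp addPR (p ∷ q ∷ []) , λ xs → ⇓comp (p⇓ xs ∷ q⇓ xs ∷ []) (addPR-correct _ _)

    recK-* : {f g : Vec ℕ k → Carrier} → RecursiveK f → RecursiveK g → RecursiveK (λ xs → f xs * g xs)
    recK-* (p , p⇓) (q , q⇓) = comp mulPR (p ∷ q ∷ []) , λ xs → ⇓comp (p⇓ xs ∷ q⇓ xs ∷ []) (mulPR-correct _ _)

    recK-neg : {f : Vec ℕ k → Carrier} → RecursiveK f → RecursiveK (λ xs → - f xs)
    recK-neg = recK-∘ (negPR , negPR-correct)

    recK-sum : ∀ {n} {f : Fin n → Vec ℕ k → Carrier} → (∀ j → RecursiveK (f j)) →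
               RecursiveK (λ xs → sum (λ j → f j xs))
    recK-sum {zero}  f = recK-const 0#
    recK-sum {suc n} f = recK-+ (f zero) (recK-sum (f ∘ suc))

  EffectiveIndex : (Carrier → ℕ) → Set
  EffectiveIndex s = ∃[ p ] ∀ x → p [ code x ∷ [] ]⇓ s x

  effective-id : Effective id
  effective-id = proj zero , λ _ → ⇓proj

  effective-const : ∀ x → Effective (λ _ → x)
  effective-const x = constPR (code x) , λ _ → ⇓const _

  effective-* : ∀ {f g} → Effective f → Effective g → Effective (λ x → f x * g x)
  effective-* (p , p⇓) (q , q⇓) =
    comp mulPR (p ∷ q ∷ []) , λ x → ⇓comp (p⇓ x ∷ q⇓ x ∷ []) (mulPR-correct _ _)

  effective-index : ∀ {h s} → Recursive₁ (code ∘ h) → EffectiveIndex s → Effective (h ∘ s)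
  effective-index (q , q⇓) (p , p⇓) = comp q (p ∷ []) , λ x → ⇓comp (p⇓ x ∷ []) (q⇓ _)

  opaque
    -- The condition is an equation between codes, tested by `dist`. Since `rec-search` needs a
    -- search that succeeds on all numbers, x enters as `decode` of a number; congruence of g
    -- removes `decode` again on genuine codes.
    effective-search : (g : ℕ → Carrier → Carrier) → (∀ m {x y} → x ≈ y → g m x ≈ g m y) →
      RecursiveK {2} (λ xs → g (lookup xs zero) (decode (lookup xs (suc zero)))) →
      (∀ x → ∃[ m ] g m x ≈ x) →
      Σ[ s ∈ (Carrier → ℕ) ] EffectiveIndex s × (∀ x → g (s x) x ≈ x)
    effective-search g g-cong g-rec total
      with s , (p , p⇓) , correct ← rec-search (rec-dist g-rec (recK-decode (rec-proj (suc zero))))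
             (λ { (a ∷ []) → let m , eq = total (decode a) in m , dist-refl (code-cong eq) })
      = (λ x → s (code x ∷ [])) , (p , λ x → p⇓ (code x ∷ [])) , λ x →
        trans (g-cong _ (sym (decode-code x)))
          (trans (code-injective (dist≡0⇒≡ (proj₁ (correct (code x ∷ []))))) (decode-code x))

  natural : ℕ → Carrier
  natural zero    = 0#
  natural (suc n) = 1# + natural n

  recK-natural : ∀ {k} {f : Vec ℕ k → ℕ} → Recursive f → RecursiveK (λ xs → natural (f xs))
  recK-natural = rec-∘₁ (prec (constPR (code 0#)) (comp addPR (constPR (code 1#) ∷ proj (suc zero) ∷ [])) , halts)
    where
    halts : ∀ n → _ [ n ∷ [] ]⇓ code (natural n)
    halts zero    = ⇓prec0 (⇓const _)
    halts (suc n) = ⇓precS (halts n) (⇓comp (⇓const _ ∷ ⇓proj ∷ []) (addPR-correct _ _))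

module PresentedField (em : ExcludedMiddle 0ℓ) {K : CommutativeRing 0ℓ 0ℓ} (P : ComputablePresentation K)
                      (isField : IsField K) where
  open CommutativeRing K hiding (zero)
  open ComputablePresentation P
  open Summation K
  open PresentedRing em P
  open FieldTheory em K isField
  open IsField isField
  open import Relation.Binary.Reasoning.Setoid setoid

  -- Solving x² y = x instead of x y = 1 makes the search total.
  quasi-inverse-search : Σ[ s ∈ (Carrier → ℕ) ] EffectiveIndex s × (∀ x → x * (x * decode (s x)) ≈ x)
  quasi-inverse-search = effective-search (λ m x → x * (x * decode m))
    (λ m x≈y → *-cong x≈y (*-congʳ x≈y))
    (recK-* X (recK-* X (recK-decode (rec-proj zero))))
    total
    where
    X = recK-decode (rec-proj {2} (suc zero))
    total : ∀ x → ∃[ m ] x * (x * decode m) ≈ x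
    total x with em {x ≈ 0#}
    ... | yes x≈0 = 0 , trans (*-congʳ x≈0) (trans (zeroˡ _) (sym x≈0))
    ... | no  x≉0 = let y , xy≈1 = inverses x x≉0 in
      code y , trans (*-congˡ (trans (*-congˡ (decode-code y)) xy≈1)) (*-identityʳ x)

  quasi-inverse : Carrier → Carrier
  quasi-inverse x = decode (proj₁ quasi-inverse-search x)

  quasi-inverse-effective : Effective quasi-inverse
  quasi-inverse-effective = effective-index code-decode-rec (proj₁ (proj₂ quasi-inverse-search))

  -- inv 0 = 0, so that inv preserves every subfield.
  inv : Carrier → Carrier
  inv x = quasi-inverse x * (x * quasi-inverse x)

  inv-effective : Effective inv
  inv-effective = effective-* quasi-inverse-effective (effective-* effective-id quasi-inverse-effective)

  inv-inverse : ∀ {x} → ¬ x ≈ 0# → x * inv x ≈ 1#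
  inv-inverse {x} x≉0 = begin
    x * (y * (x * y)) ≈⟨ *-assoc x y (x * y) ⟨
    x * y * (x * y)   ≈⟨ *-cong xy≈1 xy≈1 ⟩
    1# * 1#           ≈⟨ *-identityˡ 1# ⟩
    1#                ∎
    where
    y = quasi-inverse x
    xy≈1 : x * y ≈ 1#
    xy≈1 = nonzero-cancelˡ x≉0 (trans (proj₂ (proj₂ quasi-inverse-search) x) (sym (*-identityʳ x)))

  inv-preserves : ∀ {F : Pred Carrier 0ℓ} → IsSubfield K F → ∀ {x} → F x → F (inv x)
  inv-preserves F-subfield {x} x∈F with em {x ≈ 0#}
  ... | no  x≉0 = IsSubfield.inv-closed F-subfield x∈F (inv-inverse x≉0)
  ... | yes x≈0 = IsSubfield.resp F-subfield
    (sym (trans (*-congˡ (trans (*-congʳ x≈0) (zeroˡ _))) (zeroʳ _))) (IsSubfield.0∈ F-subfield)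

-- Enumerating ℚ and computing coordinates

module NumberField (em : ExcludedMiddle 0ℓ) {K : CommutativeRing 0ℓ 0ℓ} (numberField : IsNumberField K)
                   (P : ComputablePresentation K)
                   (galois : IsGalois K (IsNumberField.ratl numberField)) where
  open CommutativeRing K hiding (zero)
  open ComputablePresentation P
  open IsNumberField numberField
  open IsGalois galois hiding (isField)
  open IsSubfield isSubfield
  open IsField isField
  open Summation K
  open PresentedRing em P
  open PresentedField em P isField
  open FieldTheory em K isField
  open Automorphisms {K} {ratl}
  open GroupProperties +-group using (x∙y⁻¹≈ε⇒x≈y; ∙-cancelʳ)
  open import Relation.Binary.Reasoning.Setoid setoid

  natural∈ℚ : ∀ n → ratl (natural n)
  natural∈ℚ zero    = 0∈
  natural∈ℚ (suc n) = +-closed 1∈ (natural∈ℚ n)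

  opaque
    -- The triple (a , (b , c)) coded by m stands for (a - b) / (c + 1).
    rational : ℕ → Carrier
    rational m = (natural (left m) - natural (left (right m))) * inv (natural (suc (right (right m))))
      where open Pairing

    rational∈ℚ : ∀ m → ratl (rational m)
    rational∈ℚ m = *-closed
      (+-closed (natural∈ℚ (left m)) (neg-closed (natural∈ℚ (left (right m)))))
      (inv-preserves isSubfield (natural∈ℚ (suc (right (right m)))))
      where open Pairing

    recK-rational : ∀ {k} {f : Vec ℕ k → ℕ} → Recursive f → RecursiveK (λ xs → rational (f xs))
    recK-rational f = recK-*
      (recK-+ (recK-natural (rec-left f)) (recK-neg (recK-natural (rec-left (rec-right f)))))
      (recK-∘ inv-effective (recK-natural (rec-suc (rec-right (rec-right f)))))
      where open Pairing

  module ι = IsRingHomomorphism ι-homo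

  ι-natℚ : ∀ n → ι (natℚ n) ≈ natural n
  ι-natℚ zero    = ι.0#-homo
  ι-natℚ (suc n) = trans (ι.+-homo 1ℚ (natℚ n)) (+-cong ι.1#-homo (ι-natℚ n))

  -- Characteristic zero comes from `ι`, which carries the inverse of n + 1 in ℚ to an inverse in K.
  natural≉0 : ∀ n → ¬ natural (suc n) ≈ 0#
  natural≉0 n eq with r , nr≡1 ← natℚ-invertible n = 0≉1 (begin
    0#                          ≈⟨ zeroˡ (ι r) ⟨
    0# * ι r                    ≈⟨ *-congʳ eq ⟨
    natural (suc n) * ι r       ≈⟨ *-congʳ (ι-natℚ (suc n)) ⟨
    ι (natℚ (suc n)) * ι r      ≈⟨ ι.*-homo (natℚ (suc n)) r ⟨
    ι (natℚ (suc n) ℚ.* r)      ≈⟨ reflexive (≡.cong ι nr≡1) ⟩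
    ι 1ℚ                        ≈⟨ ι.1#-homo ⟩
    1#                          ∎)

  opaque
    unfolding rational

    rational-code : ∀ a b c → let open Pairing in
      rational (pair a (pair b c)) ≡ (natural a - natural b) * inv (natural (suc c))
    rational-code a b c = ≡.cong₂ _*_
      (≡.cong₂ (λ k l → natural k - natural l) (left-pair a (pair b c)) (≡.trans (≡.cong left r) (left-pair b c)))
      (≡.cong (λ k → inv (natural (suc k))) (≡.trans (≡.cong right r) (right-pair b c)))
      where
      open Pairing
      r : right (pair a (pair b c)) ≡ pair b c
      r = right-pair a (pair b c)

  rational-surjective : ∀ {x} → ratl x → ∃[ m ] rational m ≈ x
  rational-surjective {x} (q , ιq≈x) with a , b , c , eq ← fraction q =
    Pairing.pair a (Pairing.pair b c) , trans (reflexive (rational-code a b c)) (begin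
      (natural a - natural b) * inv (natural (suc c))
        ≈⟨ *-congʳ (+-congʳ (numerator a b c eq)) ⟩
      (x * natural (suc c) + natural b - natural b) * inv (natural (suc c))
        ≈⟨ *-congʳ (trans (+-assoc _ _ _) (trans (+-congˡ (-‿inverseʳ _)) (+-identityʳ _))) ⟩
      x * natural (suc c) * inv (natural (suc c))
        ≈⟨ *-assoc x (natural (suc c)) (inv (natural (suc c))) ⟩
      x * (natural (suc c) * inv (natural (suc c)))
        ≈⟨ *-congˡ (inv-inverse (natural≉0 c)) ⟩
      x * 1#
        ≈⟨ *-identityʳ x ⟩
      x ∎)
    where
    numerator : ∀ a b c → q ℚ.* natℚ (suc c) ℚ.+ natℚ b ≡ natℚ a →
                natural a ≈ x * natural (suc c) + natural b
    numerator a b c eq = begin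
      natural a                              ≈⟨ ι-natℚ a ⟨
      ι (natℚ a)                             ≈⟨ reflexive (≡.cong ι eq) ⟨
      ι (q ℚ.* natℚ (suc c) ℚ.+ natℚ b)      ≈⟨ ι.+-homo (q ℚ.* natℚ (suc c)) (natℚ b) ⟩
      ι (q ℚ.* natℚ (suc c)) + ι (natℚ b)    ≈⟨ +-cong (ι.*-homo q (natℚ (suc c))) (ι-natℚ b) ⟩
      ι q * ι (natℚ (suc c)) + natural b     ≈⟨ +-congʳ (*-cong ιq≈x (ι-natℚ (suc c))) ⟩
      x * natural (suc c) + natural b        ∎

  degree : ℕ
  degree = proj₁ finiteDegree

  basis : Vector Carrier degree
  basis = proj₁ (proj₂ finiteDegree)

  span : Vector Carrier degree → Carrier
  span c = sum (λ j → c j * basis j)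

  span-injective : ∀ {c d} → (∀ j → ratl (c j)) → (∀ j → ratl (d j)) → span c ≈ span d → ∀ j → c j ≈ d j
  span-injective {c} {d} c∈ℚ d∈ℚ eq j = x∙y⁻¹≈ε⇒x≈y _ _
    (proj₂ (proj₂ (proj₂ finiteDegree)) (λ j → c j - d j)
      (λ j → +-closed (c∈ℚ j) (neg-closed (d∈ℚ j))) (∙-cancelʳ (span d) _ _ difference-zero) j)
    where
    difference-zero : span (λ j → c j - d j) + span d ≈ 0# + span d
    difference-zero = begin
      span (λ j → c j - d j) + span d
        ≈⟨ ∑-distrib-+ (λ j → (c j - d j) * basis j) (λ j → d j * basis j) ⟨
      sum (λ j → (c j - d j) * basis j + d j * basis j)
        ≈⟨ sum-cong (λ j → trans (sym (distribʳ (basis j) (c j - d j) (d j)))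
             (*-congʳ (trans (+-assoc _ _ _) (trans (+-congˡ (-‿inverseˡ (d j))) (+-identityʳ (c j)))))) ⟩
      span c        ≈⟨ eq ⟩
      span d        ≈⟨ +-identityˡ _ ⟨
      0# + span d   ∎

  rationals : ℕ → Vector Carrier degree
  rationals m j = rational (Pairing.component j m)

  coordinates-search : Σ[ s ∈ (Carrier → ℕ) ] EffectiveIndex s × (∀ x → span (rationals (s x)) ≈ x)
  coordinates-search = effective-search (λ m _ → span (rationals m)) (λ _ _ → refl)
    (recK-sum λ j → recK-* (recK-rational (Pairing.rec-component j (rec-proj zero))) (recK-const (basis j)))
    λ x → let c , c∈ℚ , x≈ = proj₁ (proj₂ (proj₂ finiteDegree)) x
              v = λ j → proj₁ (rational-surjective (c∈ℚ j)) in
          Pairing.tuple v , trans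
            (sum-cong λ j → *-congʳ (trans (reflexive (≡.cong rational (Pairing.component-tuple v j)))
                                           (proj₂ (rational-surjective (c∈ℚ j)))))
            (sym x≈)

  opaque
    coordinate : Fin degree → Carrier → Carrier
    coordinate j x = rationals (proj₁ coordinates-search x) j

    coordinate∈ℚ : ∀ j x → ratl (coordinate j x)
    coordinate∈ℚ j x = rational∈ℚ (Pairing.component j (proj₁ coordinates-search x))

    coordinate-effective : ∀ j → Effective (coordinate j)
    coordinate-effective j =
      effective-index {h = λ m → rationals m j} (p , λ m → p⇓ (m ∷ [])) (proj₁ (proj₂ coordinates-search))
      where
      rec : RecursiveK {1} (λ xs → rationals (lookup xs zero) j)
      rec = recK-rational (Pairing.rec-component j (rec-proj zero))
      p : PR 1
      p = proj₁ rec
      p⇓ : ∀ xs → p [ xs ]⇓ code (rationals (lookup xs zero) j)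
      p⇓ = proj₂ rec

    expansion : ∀ x → span (λ j → coordinate j x) ≈ x
    expansion = proj₂ (proj₂ coordinates-search)

  -- The basis need not contain 1, so a coordinate that detects ℚ has to be found before K can be
  -- projected onto ℚ.
  1-visible : ∃[ k ] ¬ coordinate k 1# ≈ 0#
  1-visible with em {∃[ k ] ¬ coordinate k 1# ≈ 0#}
  ... | yes visible = visible
  ... | no  hidden  = ⊥-elim (0≉1 (trans (sym vanishing) (expansion 1#)))
    where
    vanishing : span (λ j → coordinate j 1#) ≈ 0#
    vanishing = sum-zero λ j → trans
      (*-congʳ (decidable-stable (em {coordinate j 1# ≈ 0#}) λ c≉0 → hidden (j , c≉0))) (zeroˡ (basis j))

  -- Every coordinate of a rational x is x times that of 1.
  retract : Carrier → Carrier
  retract x = coordinate (proj₁ 1-visible) x * inv (coordinate (proj₁ 1-visible) 1#)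

  retract∈ℚ : ∀ x → ratl (retract x)
  retract∈ℚ x = *-closed (coordinate∈ℚ (proj₁ 1-visible) x) (inv-preserves isSubfield (coordinate∈ℚ (proj₁ 1-visible) 1#))

  retract-effective : Effective retract
  retract-effective = effective-* (coordinate-effective (proj₁ 1-visible)) (effective-const (inv (coordinate (proj₁ 1-visible) 1#)))

  retract-ℚ : ∀ {x} → ratl x → retract x ≈ x
  retract-ℚ {x} x∈ℚ = begin
    coordinate k x * inv u  ≈⟨ *-congʳ (span-injective (λ j → coordinate∈ℚ j x)
                                 (λ j → *-closed x∈ℚ (coordinate∈ℚ j 1#)) same k) ⟩
    x * u * inv u           ≈⟨ *-assoc x u (inv u) ⟩
    x * (u * inv u)         ≈⟨ *-congˡ (inv-inverse (proj₂ 1-visible)) ⟩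
    x * 1#                  ≈⟨ *-identityʳ x ⟩
    x                       ∎
    where
    k = proj₁ 1-visible
    u = coordinate k 1#
    same : span (λ j → coordinate j x) ≈ span (λ j → x * coordinate j 1#)
    same = begin
      span (λ j → coordinate j x)       ≈⟨ expansion x ⟩
      x                                 ≈⟨ *-identityʳ x ⟨
      x * 1#                            ≈⟨ *-congˡ (expansion 1#) ⟨
      x * span (λ j → coordinate j 1#)  ≈⟨ *-distribˡ-sum x (λ j → coordinate j 1# * basis j) ⟩
      sum (λ j → x * (coordinate j 1# * basis j)) ≈⟨ sum-cong (λ j → sym (*-assoc x (coordinate j 1#) (basis j))) ⟩
      span (λ j → x * coordinate j 1#)  ∎

  to-expansion : ∀ (σ : Aut K ratl) x → Aut.to σ x ≈ sum (λ j → coordinate j x * Aut.to σ (basis j))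
  to-expansion σ x = trans (Aut.⟦⟧-cong σ (sym (expansion x)))
    (to-combination σ (λ j → coordinate j x) basis (λ j → coordinate∈ℚ j x))

  -- An automorphism is determined by its values on the basis, and only finitely many systems of
  -- such values occur; one representative of each therefore tests the whole group.
  finitely-many-fix-only-ℚ : Σ[ τs ∈ List (Aut K ratl) ] (∀ x → All (λ τ → Aut.to τ x ≈ x) τs → ratl x)
  finitely-many-fix-only-ℚ =
    let τs , found = finitely-many-restrictions em isField algebraic basis (λ _ → ⊤)
    in τs , λ x fixed → fixedField x λ σ →
         let τx≈x , _ , agree = All.lookupAny fixed (found σ tt) in
         trans (to-expansion σ x) (trans (sum-cong λ j → *-congˡ (sym (agree j)))
           (trans (sym (to-expansion (Any.lookup (found σ tt)) x)) τx≈x))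

-- Cohesive powers

module _ {C : Pred ℕ 0ℓ} (cohesive : Cohesive C) where

  not-almost-empty : ¬ C ⊆* (λ _ → ⊥)
  not-almost-empty (xs , C⊆xs) = proj₁ cohesive (xs , λ c → C⊆xs (c , id))

  -- The set is c.e. as the domain of a search whose body ignores the searched variable: it stops at
  -- once if p(i) = v and diverges otherwise.
  almost-dichotomy : ∀ (p : PR 1) v →
    C ⊆* (λ i → p [ i ∷ [] ]⇓ v) ⊎ C ⊆* ∁ (λ i → p [ i ∷ [] ]⇓ v)
  almost-dichotomy p v = proj₂ cohesive _ (q , λ i → mk⇔ (halts i) (λ (_ , q⇓) → value-is-v i q⇓))
    where
    test : PR 2
    test = comp (proj₁ dist-rec) (comp p (proj (suc zero) ∷ []) ∷ constPR v ∷ [])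
    q : PR 1
    q = mu test
    halts : ∀ i → p [ i ∷ [] ]⇓ v → Dom q i
    halts i p⇓ = 0 , ⇓mu (⇓comp (⇓comp (⇓proj ∷ []) p⇓ ∷ ⇓const v ∷ [])
                           (⇓-resp (dist-refl {v} ≡.refl) (proj₂ dist-rec v v))) λ ()
    value-is-v : ∀ i {n} → q [ i ∷ [] ]⇓ n → p [ i ∷ [] ]⇓ v
    value-is-v i (⇓mu (⇓comp (⇓comp (⇓proj ∷ []) p⇓ ∷ v⇓ ∷ []) d⇓) _)
      with ≡.refl ← ⇓-det v⇓ (⇓const v) = ⇓-resp (dist≡0⇒≡ (⇓-det (proj₂ dist-rec _ v) d⇓)) p⇓

-- Classes and their values at single indices

module PointwiseReasoning (em : ExcludedMiddle 0ℓ) {K : CommutativeRing 0ℓ 0ℓ} (P : ComputablePresentation K)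
                          (C : Pred ℕ 0ℓ) where
  open CommutativeRing K hiding (zero)
  open ComputablePresentation P
  open PresentedRing em P
  module K = Summation K
  module L = CommutativeRing (∏ P C)
  module ∑ = Summation (∏ P C)
  open PCF

  infix 4 _at_↦_
  _at_↦_ : PCF P C → ℕ → Carrier → Set
  _at_↦_ = _⟨_⟩↦_ P C

  ↦-functional : ∀ φ {i x y} → φ at i ↦ x → φ at i ↦ y → x ≈ y
  ↦-functional φ p q = code-injective (⇓-det p q)

  ≋⇒almost : ∀ φ ψ → φ L.≈ ψ → C ⊆* λ i → ∃[ x ] φ at i ↦ x × ψ at i ↦ x
  ≋⇒almost φ ψ = ⊆*-mono λ (y , p , q) → values p q (valued φ p)
    where
    values : ∀ {i y} → prog φ [ i ∷ [] ]⇓ y → prog ψ [ i ∷ [] ]⇓ y → Domain y →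
             ∃[ x ] φ at i ↦ x × ψ at i ↦ x
    values p q (x , ≡.refl) = x , p , q

  almost⇒≋ : ∀ φ ψ → C ⊆* (λ i → ∃[ x ] ∃[ y ] x ≈ y × φ at i ↦ x × ψ at i ↦ y) → φ L.≈ ψ
  almost⇒≋ φ ψ = ⊆*-mono λ (x , y , x≈y , p , q) → agree P C φ ψ x≈y p q

  ≋-at : ∀ φ ψ → (∀ {i x} → φ at i ↦ x → ψ at i ↦ x) → φ L.≈ ψ
  ≋-at φ ψ same = almost⇒≋ φ ψ (⊆*-mono (λ (x , p) → x , x , refl , p , same p) (defined P C φ))

  module _ {h} (h-eff : Effective h) where

    apply : PCF P C → PCF P C
    apply = unary P C h (proj₁ h-eff) (proj₂ h-eff)

    apply↦ : ∀ φ {i x} → φ at i ↦ x → apply φ at i ↦ h x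
    apply↦ φ p = ⇓comp (p ∷ []) (proj₂ h-eff _)

    -- Reads a computation backwards. Membership in `∏-sub` speaks of all values of a
    -- representative, so the forward rule `apply↦` alone cannot establish it.
    apply-values : ∀ φ {i z} → apply φ at i ↦ z → ∃[ x ] φ at i ↦ x × z ≈ h x
    apply-values φ (⇓comp (p ∷ []) r) with valued φ p
    ... | x , ≡.refl = x , p , code-injective (⇓-det r (proj₂ h-eff x))

  add-values : ∀ φ ψ {i z} → φ L.+ ψ at i ↦ z → ∃[ x ] ∃[ y ] φ at i ↦ x × ψ at i ↦ y × z ≈ x + y
  add-values φ ψ (⇓comp (p ∷ q ∷ []) r) with valued φ p | valued ψ q
  ... | x , ≡.refl | y , ≡.refl = x , y , p , q , code-injective (⇓-det r (addPR-correct x y))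

  mul-values : ∀ φ ψ {i z} → φ L.* ψ at i ↦ z → ∃[ x ] ∃[ y ] φ at i ↦ x × ψ at i ↦ y × z ≈ x * y
  mul-values φ ψ (⇓comp (p ∷ q ∷ []) r) with valued φ p | valued ψ q
  ... | x , ≡.refl | y , ≡.refl = x , y , p , q , code-injective (⇓-det r (mulPR-correct x y))

  neg-values : ∀ φ {i z} → L.- φ at i ↦ z → ∃[ x ] φ at i ↦ x × z ≈ - x
  neg-values = apply-values (negPR , negPR-correct)

  const-values : ∀ x {i y} → const P C x at i ↦ y → y ≈ x
  const-values x p = ↦-functional (const P C x) p (const↦ P C x)

  sum↦ : ∀ {n} (φ : Vector (PCF P C) n) {x : Vector Carrier n} {i} →
         (∀ j → φ j at i ↦ x j) → ∑.sum φ at i ↦ K.sum x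
  sum↦ {zero}  φ p = const↦ P C 0#
  sum↦ {suc n} φ p = add↦ P C (head φ) (∑.sum (tail φ)) (p zero) (sum↦ (tail φ) (p ∘ suc))

  eval-const↦ : ∀ {n} (a : Vector Carrier n) φ {i x} → φ at i ↦ x → ∑.eval (const P C ∘ a) φ at i ↦ K.eval a x
  eval-const↦ {zero}  a φ p = const↦ P C 0#
  eval-const↦ {suc n} a φ p = add↦ P C (const P C (head a)) (φ L.* rest) (const↦ P C (head a))
    (mul↦ P C φ rest p (eval-const↦ (tail a) φ p))
    where rest = ∑.eval (const P C ∘ tail a) φ

  const-cong : ∀ {x y} → x ≈ y → const P C x L.≈ const P C y
  const-cong {x} {y} x≈y = ≋-at (const P C x) (const P C y) λ p →
    resp↦ P C (const P C y) (trans (sym x≈y) (sym (const-values x p))) (const↦ P C y)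

  const-injective : Cohesive C → ∀ {x y} → const P C x L.≈ const P C y → x ≈ y
  const-injective cohesive {x} {y} eq = decidable-stable em λ x≉y → not-almost-empty cohesive
    (⊆*-mono (λ (z , p , q) → x≉y (trans (sym (const-values x p)) (const-values y q)))
             (≋⇒almost (const P C x) (const P C y) eq))

  -- Each candidate is taken either almost everywhere or almost nowhere on C, and in the second case
  -- it is struck off. The list cannot run out, because C is infinite.
  almost-constant : Cohesive C → ∀ φ (ys : List Carrier) → C ⊆* (λ i → ∃[ x ] φ at i ↦ x × Any (x ≈_) ys) →
                    ∃[ y ] φ L.≈ const P C y
  almost-constant cohesive φ []       inside = ⊥-elim (not-almost-empty cohesive (⊆*-mono (λ ()) inside))
  almost-constant cohesive φ (y ∷ ys) inside with almost-dichotomy cohesive (prog φ) (code y)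
  ... | inj₁ φ↦y = y , almost⇒≋ φ (const P C y) (⊆*-mono (λ p → y , y , refl , p , const↦ P C y) φ↦y)
  ... | inj₂ φ↦̸y = almost-constant cohesive φ ys (⊆*-mono
    (λ { (¬p , x , p , here x≈y) → ⊥-elim (¬p (resp↦ P C φ x≈y p))
       ; (¬p , x , p , there x∈ys) → x , p , x∈ys }) (⊆*-∩ φ↦̸y inside))

-- ∏K as a field extension of ∏ℚ

module GaloisPower (em : ExcludedMiddle 0ℓ) {K : CommutativeRing 0ℓ 0ℓ} (numberField : IsNumberField K)
                   (P : ComputablePresentation K) {C : Pred ℕ 0ℓ} (cohesive : Cohesive C)
                   (galois : IsGalois K (IsNumberField.ratl numberField)) where
  open CommutativeRing K hiding (zero)
  open ComputablePresentation P
  open PresentedRing em P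
  open IsNumberField numberField using (isField; ratl)
  open IsGalois galois using (algebraic; isSubfield)
  open PresentedField em P isField
  open FieldTheory em K isField
  open NumberField em numberField P galois
  open PointwiseReasoning em P C
  open Automorphisms
  open PCF using (prog)
  module Rat = IsSubfield isSubfield

  ∏K : CommutativeRing 0ℓ 0ℓ
  ∏K = ∏ P C

  ∏ℚ : Pred (PCF P C) 0ℓ
  ∏ℚ = ∏-sub P C ratl

  K₀ : Carrier → PCF P C
  K₀ = const P C

  invᶜ : PCF P C → PCF P C
  invᶜ = apply inv-effective

  ∏-isField : IsField ∏K
  ∏-isField = record
    { 0≉1      = λ 0≋1 → IsField.0≉1 isField (const-injective cohesive 0≋1)
    ; inverses = λ φ φ≉0 → invᶜ φ , inverse φ φ≉0
    }
    where
    -- The hypothesis only denies that φ is zero almost everywhere; the dichotomy strengthens it to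
    -- nonzero almost everywhere.
    inverse : ∀ φ → ¬ φ L.≈ L.0# → φ L.* invᶜ φ L.≈ L.1#
    inverse φ φ≉0 with almost-dichotomy cohesive (prog φ) (code 0#)
    ... | inj₁ φ↦0 = ⊥-elim (φ≉0 (almost⇒≋ φ (K₀ 0#)
                       (⊆*-mono (λ p → 0# , 0# , refl , p , const↦ P C 0#) φ↦0)))
    ... | inj₂ φ↦̸0 = almost⇒≋ (φ L.* invᶜ φ) (K₀ 1#) (⊆*-mono
      (λ (¬p , x , p) → x * inv x , 1# , inv-inverse (λ x≈0 → ¬p (resp↦ P C φ x≈0 p)) ,
                        mul↦ P C φ (invᶜ φ) p (apply↦ inv-effective φ p) , const↦ P C 1#)
      (⊆*-∩ φ↦̸0 (defined P C φ)))

  K₀-ℚ : ∀ {x} → ratl x → ∏ℚ (K₀ x)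
  K₀-ℚ {x} x∈ℚ = K₀ x , L.refl {K₀ x} , λ p → Rat.resp (sym (const-values x p)) x∈ℚ

  ∏-isSubfield : IsSubfield ∏K ∏ℚ
  ∏-isSubfield = record
    { resp       = λ {φ} {ψ} φ≋ψ (φ′ , φ≋φ′ , φ′∈ℚ) → φ′ , L.trans {ψ} {φ} {φ′} (L.sym {φ} {ψ} φ≋ψ) φ≋φ′ , φ′∈ℚ
    ; 0∈         = K₀-ℚ Rat.0∈
    ; 1∈         = K₀-ℚ Rat.1∈
    ; +-closed   = λ {φ} {ψ} (φ′ , φ≋φ′ , φ′∈ℚ) (ψ′ , ψ≋ψ′ , ψ′∈ℚ) →
        φ′ L.+ ψ′ , L.+-cong {φ} {φ′} {ψ} {ψ′} φ≋φ′ ψ≋ψ′ , λ r →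
        let x , y , p , q , z≈ = add-values φ′ ψ′ r in Rat.resp (sym z≈) (Rat.+-closed (φ′∈ℚ p) (ψ′∈ℚ q))
    ; *-closed   = λ {φ} {ψ} (φ′ , φ≋φ′ , φ′∈ℚ) (ψ′ , ψ≋ψ′ , ψ′∈ℚ) →
        φ′ L.* ψ′ , L.*-cong {φ} {φ′} {ψ} {ψ′} φ≋φ′ ψ≋ψ′ , λ r →
        let x , y , p , q , z≈ = mul-values φ′ ψ′ r in Rat.resp (sym z≈) (Rat.*-closed (φ′∈ℚ p) (ψ′∈ℚ q))
    ; neg-closed = λ {φ} (φ′ , φ≋φ′ , φ′∈ℚ) →
        L.- φ′ , L.-‿cong {φ} {φ′} φ≋φ′ , λ r →
        let x , p , z≈ = neg-values φ′ r in Rat.resp (sym z≈) (Rat.neg-closed (φ′∈ℚ p))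
    -- ψ need not have rational values off C, so it is replaced by `invᶜ φ′`, which is rational even
    -- at indices where φ′ vanishes.
    ; inv-closed = λ {φ} {ψ} (φ′ , φ≋φ′ , φ′∈ℚ) φψ≋1 →
        invᶜ φ′ , inverse-unique φ φ′ ψ φ≋φ′ φψ≋1 , λ r →
        let x , p , z≈ = apply-values inv-effective φ′ r in
        Rat.resp (sym z≈) (inv-preserves isSubfield (φ′∈ℚ p))
    }
    where
    inverse-unique : ∀ φ φ′ ψ → φ L.≈ φ′ → φ L.* ψ L.≈ L.1# → ψ L.≈ invᶜ φ′
    inverse-unique φ φ′ ψ φ≋φ′ φψ≋1 = almost⇒≋ ψ (invᶜ φ′) (⊆*-mono
      (λ ((x , p , p′) , (y , q) , (z , r , one)) →
        let xy≈1 = trans (↦-functional (φ L.* ψ) (mul↦ P C φ ψ p q) r) (const-values 1# one)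
            x≉0 = λ x≈0 → IsField.0≉1 isField (trans (sym (zeroˡ y)) (trans (*-congʳ (sym x≈0)) xy≈1))
        in y , inv x , nonzero-cancelˡ x≉0 (trans xy≈1 (sym (inv-inverse x≉0))) , q , apply↦ inv-effective φ′ p′)
      (⊆*-∩ (≋⇒almost φ φ′ φ≋φ′) (⊆*-∩ (defined P C ψ) (≋⇒almost (φ L.* ψ) L.1# φψ≋1))))

  coordinateᶜ : Fin degree → PCF P C → PCF P C
  coordinateᶜ j = apply (coordinate-effective j)

  coordinateᶜ∈∏ℚ : ∀ j φ → ∏ℚ (coordinateᶜ j φ)
  coordinateᶜ∈∏ℚ j φ = coordinateᶜ j φ , L.refl {coordinateᶜ j φ} , λ r →
    let x , p , z≈ = apply-values (coordinate-effective j) φ r in Rat.resp (sym z≈) (coordinate∈ℚ j x)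

  -- With e the basis this is φ again; with e the images of the basis under an automorphism it is
  -- the image of φ.
  combination : (Fin degree → Carrier) → PCF P C → PCF P C
  combination e φ = ∑.sum (λ j → coordinateᶜ j φ L.* K₀ (e j))

  combination↦ : ∀ e φ {i x} → φ at i ↦ x → combination e φ at i ↦ K.sum (λ j → coordinate j x * e j)
  combination↦ e φ p = sum↦ (λ j → coordinateᶜ j φ L.* K₀ (e j)) λ j →
    mul↦ P C (coordinateᶜ j φ) (K₀ (e j)) (apply↦ (coordinate-effective j) φ p) (const↦ P C (e j))

  expansionᶜ : ∀ φ → φ L.≈ combination basis φ
  expansionᶜ φ = ≋-at φ (combination basis φ) λ {i} {x} p →
    resp↦ P C (combination basis φ) (expansion x) (combination↦ basis φ p)

  ∏-algebraic : ∀ φ → IsAlgebraic ∏K ∏ℚ φ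
  ∏-algebraic φ =
    -- The d + 1 coordinate vectors have length d. Elimination takes place between classes in the
    -- field ∏K, not separately at each index.
    let c , c∈∏ℚ , c≉0 , dependence = FieldTheory.linearly-dependent em ∏K ∏-isField ∏-isSubfield degree v
          (λ i j → coordinateᶜ∈∏ℚ j (power i))
    in suc degree , c , c∈∏ℚ , c≉0 , root c dependence
    where
    power : Fin (suc degree) → PCF P C
    power i = φ ∑.^ toℕ i
    v : Fin (suc degree) → Vector (PCF P C) degree
    v i j = coordinateᶜ j (power i)
    open import Relation.Binary.Reasoning.Setoid L.setoid
    root : ∀ c → (∀ j → ∑.sum (λ i → c i L.* v i j) L.≈ L.0#) → ∑.sum (λ i → c i L.* power i) L.≈ L.0#
    root c dependence = begin
      ∑.sum (λ i → c i L.* power i)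
        ≈⟨ ∑.sum-cong {x = λ i → c i L.* power i} {λ i → c i L.* combination basis (power i)}
             (λ i → L.*-congˡ {c i} {power i} {combination basis (power i)} (expansionᶜ (power i))) ⟩
      ∑.sum (λ i → c i L.* combination basis (power i))
        ≈⟨ ∑.sum-swap c v (K₀ ∘ basis) ⟩
      ∑.sum (λ j → ∑.sum (λ i → c i L.* v i j) L.* K₀ (basis j))
        ≈⟨ ∑.sum-zero {t = λ j → ∑.sum (λ i → c i L.* v i j) L.* K₀ (basis j)} (λ j →
             L.trans {∑.sum (λ i → c i L.* v i j) L.* K₀ (basis j)} {L.0# L.* K₀ (basis j)} {L.0#}
               (L.*-congʳ {K₀ (basis j)} {∑.sum (λ i → c i L.* v i j)} {L.0#} (dependence j))
               (L.zeroˡ (K₀ (basis j)))) ⟩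
      L.0# ∎

  -- Lifting automorphisms from K to ∏K

  module Lift (σ : Aut K ratl) where
    module σ = Aut σ

    lift : PCF P C → PCF P C
    lift = combination (σ.to ∘ basis)

    -- At each index `lift` is σ itself, so the laws of σ in K pass to classes index by index.
    lift↦ : ∀ φ {i x} → φ at i ↦ x → lift φ at i ↦ σ.to x
    lift↦ φ {x = x} p = resp↦ P C (lift φ) (sym (to-expansion σ x)) (combination↦ (σ.to ∘ basis) φ p)

    lift-cong : ∀ φ ψ → φ L.≈ ψ → lift φ L.≈ lift ψ
    lift-cong φ ψ φ≋ψ = almost⇒≋ (lift φ) (lift ψ) (⊆*-mono
      (λ (x , p , q) → σ.to x , σ.to x , refl , lift↦ φ p , lift↦ ψ q) (≋⇒almost φ ψ φ≋ψ))

    lift-injective : ∀ φ ψ → lift φ L.≈ lift ψ → φ L.≈ ψ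
    lift-injective φ ψ eq = almost⇒≋ φ ψ (⊆*-mono
      (λ ((x , p) , (y , q) , (z , r , s)) → x , y , σ.injective
        (trans (↦-functional (lift φ) (lift↦ φ p) r) (↦-functional (lift ψ) s (lift↦ ψ q))) , p , q)
      (⊆*-∩ (defined P C φ) (⊆*-∩ (defined P C ψ) (≋⇒almost (lift φ) (lift ψ) eq))))

    lift-+ : ∀ φ ψ → lift (φ L.+ ψ) L.≈ lift φ L.+ lift ψ
    lift-+ φ ψ = law₂ P C φ ψ (lift (φ L.+ ψ)) (lift φ L.+ lift ψ) λ p q →
      agree P C (lift (φ L.+ ψ)) (lift φ L.+ lift ψ) (σ.+-homo _ _)
        (lift↦ (φ L.+ ψ) (add↦ P C φ ψ p q)) (add↦ P C (lift φ) (lift ψ) (lift↦ φ p) (lift↦ ψ q))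

    lift-* : ∀ φ ψ → lift (φ L.* ψ) L.≈ lift φ L.* lift ψ
    lift-* φ ψ = law₂ P C φ ψ (lift (φ L.* ψ)) (lift φ L.* lift ψ) λ p q →
      agree P C (lift (φ L.* ψ)) (lift φ L.* lift ψ) (σ.*-homo _ _)
        (lift↦ (φ L.* ψ) (mul↦ P C φ ψ p q)) (mul↦ P C (lift φ) (lift ψ) (lift↦ φ p) (lift↦ ψ q))

    lift-neg : ∀ φ → lift (L.- φ) L.≈ L.- lift φ
    lift-neg φ = law₁ P C φ (lift (L.- φ)) (L.- lift φ) λ p →
      agree P C (lift (L.- φ)) (L.- lift φ) (σ.-‿homo _)
        (lift↦ (L.- φ) (neg↦ P C φ p)) (neg↦ P C (lift φ) (lift↦ φ p))

    lift-const : ∀ x → lift (K₀ x) L.≈ K₀ (σ.to x)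
    lift-const x = almost⇒≋ (lift (K₀ x)) (K₀ (σ.to x))
      (⊆*-univ λ i → σ.to x , σ.to x , refl , lift↦ (K₀ x) (const↦ P C x) , const↦ P C (σ.to x))

    lift-fixes : ∀ φ → ∏ℚ φ → lift φ L.≈ φ
    lift-fixes φ (φ′ , φ≋φ′ , φ′∈ℚ) = almost⇒≋ (lift φ) φ (⊆*-mono
      (λ (x , p , p′) → σ.to x , x , σ.fixes (φ′∈ℚ p′) , lift↦ φ p , p) (≋⇒almost φ φ′ φ≋φ′))

  lift∘lift : ∀ σ τ φ → (∀ x → Aut.to σ (Aut.to τ x) ≈ x) → Lift.lift σ (Lift.lift τ φ) L.≈ φ
  lift∘lift σ τ φ στ≈id = law₁ P C φ (Lift.lift σ (Lift.lift τ φ)) φ λ p →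
    agree P C (Lift.lift σ (Lift.lift τ φ)) φ (στ≈id _) (Lift.lift↦ σ (Lift.lift τ φ) (Lift.lift↦ τ φ p)) p

  liftAut : Aut K ratl → Aut ∏K ∏ℚ
  liftAut σ = record
    { to    = lift
    ; isIso = record
      { isRingMonomorphism = record
        { isRingHomomorphism = record
          { isSemiringHomomorphism = record
            { isNearSemiringHomomorphism = record
              { +-isMonoidHomomorphism = record
                { isMagmaHomomorphism = record
                  { isRelHomomorphism = record { cong = λ {φ} {ψ} → lift-cong φ ψ }
                  ; homo = lift-+
                  }
                ; ε-homo = lift-to 0# σ.0#-homo
                }
              ; *-homo = lift-*
              }
            ; 1#-homo = lift-to 1# σ.1#-homo
            }
          ; -‿homo = lift-neg
          }
        ; injective = λ {φ} {ψ} → lift-injective φ ψ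
        }
      ; surjective = λ ψ → Lift.lift σ⁻¹ ψ , λ {φ} φ≋ →
          L.trans {lift φ} {lift (Lift.lift σ⁻¹ ψ)} {ψ} (lift-cong φ (Lift.lift σ⁻¹ ψ) φ≋)
            (lift∘lift σ σ⁻¹ ψ (Aut.to∘from σ))
      }
    ; fixes = λ {φ} → lift-fixes φ
    }
    where
    open Lift σ
    σ⁻¹ = invAut K ratl σ
    lift-to : ∀ x → σ.to x ≈ x → lift (K₀ x) L.≈ K₀ x
    lift-to x σx≈x = L.trans {lift (K₀ x)} {K₀ (σ.to x)} {K₀ x} (lift-const x) (const-cong σx≈x)

  -- Testing φ against the lifts of the finite list already makes its values rational almost
  -- everywhere on C. Composing with `retract` leaves those values alone and makes the others
  -- rational too, as a representative for ∏ℚ requires.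
  ∏-fixedField : ∀ φ → (∀ Σ → Aut.to {∏K} {∏ℚ} Σ φ L.≈ φ) → ∏ℚ φ
  ∏-fixedField φ fixed =
    apply retract-effective φ ,
    almost⇒≋ φ (apply retract-effective φ) (⊆*-mono
      (λ (x , p , x∈ℚ) → x , retract x , sym (retract-ℚ x∈ℚ) , p , apply↦ retract-effective φ p)
      almost-rational) ,
    λ r → let x , _ , z≈ = apply-values retract-effective φ r in Rat.resp (sym z≈) (retract∈ℚ x)
    where
    almost-fixed : ∀ (τs : List (Aut K ratl)) → C ⊆* λ i → ∃[ x ] φ at i ↦ x × All (λ τ → Aut.to τ x ≈ x) τs
    almost-fixed []       = ⊆*-mono (λ (x , p) → x , p , []) (defined P C φ)
    almost-fixed (τ ∷ τs) = ⊆*-mono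
      (λ ((x , p , rest) , (y , q , r)) → x , p ,
        trans (↦-functional (lift φ) (lift↦ φ p) q) (↦-functional φ r p) ∷ rest)
      (⊆*-∩ (almost-fixed τs) (≋⇒almost (lift φ) φ (fixed (liftAut τ))))
      where open Lift τ
    almost-rational : C ⊆* λ i → ∃[ x ] φ at i ↦ x × ratl x
    almost-rational = ⊆*-mono (λ (x , p , fix) → x , p , proj₂ finitely-many-fix-only-ℚ x fix)
                              (almost-fixed (proj₁ finitely-many-fix-only-ℚ))

  ∏-isGalois : IsGalois ∏K ∏ℚ
  ∏-isGalois = record
    { isField    = ∏-isField
    ; isSubfield = ∏-isSubfield
    ; algebraic  = ∏-algebraic
    ; fixedField = ∏-fixedField
    }

  const-+ : ∀ x y → K₀ (x + y) L.≈ K₀ x L.+ K₀ y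
  const-+ x y = ≋-at (K₀ (x + y)) (K₀ x L.+ K₀ y) λ p → resp↦ P C (K₀ x L.+ K₀ y)
    (sym (const-values (x + y) p)) (add↦ P C (K₀ x) (K₀ y) (const↦ P C x) (const↦ P C y))

  const-* : ∀ x y → K₀ (x * y) L.≈ K₀ x L.* K₀ y
  const-* x y = ≋-at (K₀ (x * y)) (K₀ x L.* K₀ y) λ p → resp↦ P C (K₀ x L.* K₀ y)
    (sym (const-values (x * y) p)) (mul↦ P C (K₀ x) (K₀ y) (const↦ P C x) (const↦ P C y))

  const-neg : ∀ x → K₀ (- x) L.≈ L.- K₀ x
  const-neg x = ≋-at (K₀ (- x)) (L.- K₀ x) λ p → resp↦ P C (L.- K₀ x)
    (sym (const-values (- x) p)) (neg↦ P C (K₀ x) (const↦ P C x))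

  -- Restricting automorphisms of ∏K to the constants

  module Restrict (Σ : Aut ∏K ∏ℚ) where
    module Σ = Aut Σ
    open import Relation.Binary.Reasoning.Setoid L.setoid

    constant-image : ∀ x → ∃[ y ] Σ.to (K₀ x) L.≈ K₀ y
    constant-image x
      with n , a , a∈ℚ , a≉0 , root ← algebraic x
      with rs , complete ← finitely-many-roots a a≉0 =
      almost-constant cohesive φ rs (⊆*-mono
        -- The polynomial has constant coefficients, so at almost every index of C the value of φ is
        -- a root in K of one and the same polynomial.
        (λ ((y , p) , (z , q , zero↦)) → y , p ,
          complete y (trans (↦-functional (∑.eval (K₀ ∘ a) φ) (eval-const↦ a φ p) q) (const-values 0# zero↦)))
        (⊆*-∩ (defined P C φ) (≋⇒almost (∑.eval (K₀ ∘ a) φ) L.0# φ-root)))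
      where
      φ : PCF P C
      φ = Σ.to (K₀ x)
      φ-root : ∑.eval (K₀ ∘ a) φ L.≈ L.0#
      φ-root = to-root Σ (K₀ ∘ a) {K₀ x} (λ j → K₀-ℚ (a∈ℚ j))
        (almost⇒≋ (∑.eval (K₀ ∘ a) (K₀ x)) L.0# (⊆*-univ λ i →
          K.eval a x , 0# , trans (sym (K.sum≈eval a x)) root , eval-const↦ a (K₀ x) (const↦ P C x) , const↦ P C 0#))

    restrict : Carrier → Carrier
    restrict x = proj₁ (constant-image x)

    to-const : ∀ x → Σ.to (K₀ x) L.≈ K₀ (restrict x)
    to-const x = proj₂ (constant-image x)

    -- Constants embed K injectively. The laws of `restrict` follow by computing `Σ` on constants
    -- and reading off the result.
    restrict-unique : ∀ {x y} → Σ.to (K₀ x) L.≈ K₀ y → restrict x ≈ y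
    restrict-unique {x} {y} eq = const-injective cohesive (begin
      K₀ (restrict x) ≈⟨ to-const x ⟨
      Σ.to (K₀ x)     ≈⟨ eq ⟩
      K₀ y            ∎)

    restrict-cong : ∀ {x y} → x ≈ y → restrict x ≈ restrict y
    restrict-cong {x} {y} x≈y = restrict-unique (begin
      Σ.to (K₀ x)      ≈⟨ Σ.⟦⟧-cong {K₀ x} {K₀ y} (const-cong x≈y) ⟩
      Σ.to (K₀ y)      ≈⟨ to-const y ⟩
      K₀ (restrict y)  ∎)

    restrict-injective : ∀ {x y} → restrict x ≈ restrict y → x ≈ y
    restrict-injective {x} {y} eq = const-injective cohesive (Σ.injective {K₀ x} {K₀ y} (begin
      Σ.to (K₀ x)      ≈⟨ to-const x ⟩
      K₀ (restrict x)  ≈⟨ const-cong eq ⟩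
      K₀ (restrict y)  ≈⟨ to-const y ⟨
      Σ.to (K₀ y)      ∎))

    restrict-+ : ∀ x y → restrict (x + y) ≈ restrict x + restrict y
    restrict-+ x y = restrict-unique (begin
      Σ.to (K₀ (x + y))                    ≈⟨ Σ.⟦⟧-cong {K₀ (x + y)} {K₀ x L.+ K₀ y} (const-+ x y) ⟩
      Σ.to (K₀ x L.+ K₀ y)                 ≈⟨ Σ.+-homo (K₀ x) (K₀ y) ⟩
      Σ.to (K₀ x) L.+ Σ.to (K₀ y)
        ≈⟨ L.+-cong {Σ.to (K₀ x)} {K₀ (restrict x)} {Σ.to (K₀ y)} {K₀ (restrict y)} (to-const x) (to-const y) ⟩
      K₀ (restrict x) L.+ K₀ (restrict y)  ≈⟨ const-+ (restrict x) (restrict y) ⟨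
      K₀ (restrict x + restrict y)         ∎)

    restrict-* : ∀ x y → restrict (x * y) ≈ restrict x * restrict y
    restrict-* x y = restrict-unique (begin
      Σ.to (K₀ (x * y))                    ≈⟨ Σ.⟦⟧-cong {K₀ (x * y)} {K₀ x L.* K₀ y} (const-* x y) ⟩
      Σ.to (K₀ x L.* K₀ y)                 ≈⟨ Σ.*-homo (K₀ x) (K₀ y) ⟩
      Σ.to (K₀ x) L.* Σ.to (K₀ y)
        ≈⟨ L.*-cong {Σ.to (K₀ x)} {K₀ (restrict x)} {Σ.to (K₀ y)} {K₀ (restrict y)} (to-const x) (to-const y) ⟩
      K₀ (restrict x) L.* K₀ (restrict y)  ≈⟨ const-* (restrict x) (restrict y) ⟨
      K₀ (restrict x * restrict y)         ∎)

    restrict-neg : ∀ x → restrict (- x) ≈ - restrict x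
    restrict-neg x = restrict-unique (begin
      Σ.to (K₀ (- x))      ≈⟨ Σ.⟦⟧-cong {K₀ (- x)} {L.- K₀ x} (const-neg x) ⟩
      Σ.to (L.- K₀ x)      ≈⟨ Σ.-‿homo (K₀ x) ⟩
      L.- Σ.to (K₀ x)      ≈⟨ L.-‿cong {Σ.to (K₀ x)} {K₀ (restrict x)} (to-const x) ⟩
      L.- K₀ (restrict x)  ≈⟨ const-neg (restrict x) ⟨
      K₀ (- restrict x)    ∎)

    restrict-ℚ : ∀ {x} → ratl x → restrict x ≈ x
    restrict-ℚ {x} x∈ℚ = restrict-unique (Σ.fixes {K₀ x} (K₀-ℚ x∈ℚ))

    -- The constants e_j span ∏K over ∏ℚ.
    to-determined : ∀ φ → Σ.to φ L.≈ combination (restrict ∘ basis) φ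
    to-determined φ = begin
      Σ.to φ
        ≈⟨ Σ.⟦⟧-cong {φ} {combination basis φ} (expansionᶜ φ) ⟩
      Σ.to (combination basis φ)
        ≈⟨ to-combination Σ (λ j → coordinateᶜ j φ) (K₀ ∘ basis) (λ j → coordinateᶜ∈∏ℚ j φ) ⟩
      ∑.sum (λ j → coordinateᶜ j φ L.* Σ.to (K₀ (basis j)))
        ≈⟨ ∑.sum-cong {x = λ j → coordinateᶜ j φ L.* Σ.to (K₀ (basis j))}
             {λ j → coordinateᶜ j φ L.* K₀ (restrict (basis j))} (λ j →
             L.*-congˡ {coordinateᶜ j φ} {Σ.to (K₀ (basis j))} {K₀ (restrict (basis j))} (to-const (basis j))) ⟩
      combination (restrict ∘ basis) φ ∎

  -- The isomorphism of Galois groups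

  open Restrict using (restrict; to-const; restrict-unique)

  -- Gives the surjectivity of the restriction: the inverse of `Σ` also maps constants to constants.
  restrict-inverse : ∀ Σ y → restrict Σ (restrict (invAut ∏K ∏ℚ Σ) y) ≈ y
  restrict-inverse Σ y = restrict-unique Σ (begin
    Aut.to Σ (K₀ (restrict Σ⁻¹ y))     ≈⟨ Aut.⟦⟧-cong Σ {Aut.from Σ (K₀ y)} {K₀ (restrict Σ⁻¹ y)} (to-const Σ⁻¹ y) ⟨
    Aut.to Σ (Aut.from Σ (K₀ y))       ≈⟨ Aut.to∘from Σ (K₀ y) ⟩
    K₀ y                               ∎)
    where
    open import Relation.Binary.Reasoning.Setoid L.setoid
    Σ⁻¹ = invAut ∏K ∏ℚ Σ

  restrictAut : Aut ∏K ∏ℚ → Aut K ratl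
  restrictAut Σ = record
    { to    = restrict Σ
    ; isIso = record
      { isRingMonomorphism = record
        { isRingHomomorphism = record
          { isSemiringHomomorphism = record
            { isNearSemiringHomomorphism = record
              { +-isMonoidHomomorphism = record
                { isMagmaHomomorphism = record
                  { isRelHomomorphism = record { cong = R.restrict-cong }
                  ; homo = R.restrict-+
                  }
                ; ε-homo = R.restrict-ℚ Rat.0∈
                }
              ; *-homo = R.restrict-*
              }
            ; 1#-homo = R.restrict-ℚ Rat.1∈
            }
          ; -‿homo = R.restrict-neg
          }
        ; injective = R.restrict-injective
        }
      ; surjective = λ y → restrict (invAut ∏K ∏ℚ Σ) y , λ x≈ →
          trans (R.restrict-cong x≈) (restrict-inverse Σ y)
      }
    ; fixes = R.restrict-ℚ
    }
    where module R = Restrict Σ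

  -- Restriction is injective because `to-determined` recovers an automorphism from its values on
  -- the constant basis, and onto because the lift of σ restricts to σ.
  Gal-∏≅Gal : Gal ∏K ∏ℚ ≅ Gal K ratl
  Gal-∏≅Gal = restrictAut , record
    { isGroupMonomorphism = record
      { isGroupHomomorphism = record
        { isMonoidHomomorphism = record
          { isMagmaHomomorphism = record
            { isRelHomomorphism = record { cong = λ {Σ} {Τ} → restrict-Σ-cong Σ Τ }
            ; homo = restrict-∘
            }
          ; ε-homo = λ x → restrict-unique (idAut ∏K ∏ℚ) (L.refl {K₀ x})
          }
        ; ⁻¹-homo = λ Σ x → Aut.injective (restrictAut Σ)
            (trans (restrict-inverse Σ x) (sym (Aut.to∘from (restrictAut Σ) x)))
        }
      ; injective = λ {Σ} {Τ} → injective Σ Τ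
      }
    ; surjective = λ σ → liftAut σ , λ {Τ} Τ≈ x → trans (restrict-Σ-cong Τ (liftAut σ) Τ≈ x)
        (restrict-unique (liftAut σ) (Lift.lift-const σ x))
    }
    where
    open import Relation.Binary.Reasoning.Setoid L.setoid
    restrict-Σ-cong : ∀ Σ Τ → (∀ φ → Aut.to Σ φ L.≈ Aut.to Τ φ) → ∀ x → restrict Σ x ≈ restrict Τ x
    restrict-Σ-cong Σ Τ Σ≈Τ x = restrict-unique Σ (begin
      Aut.to Σ (K₀ x)     ≈⟨ Σ≈Τ (K₀ x) ⟩
      Aut.to Τ (K₀ x)     ≈⟨ to-const Τ x ⟩
      K₀ (restrict Τ x)   ∎)
    restrict-∘ : ∀ Σ Τ x → restrict (_∘Aut_ ∏K ∏ℚ Σ Τ) x ≈ restrict Σ (restrict Τ x)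
    restrict-∘ Σ Τ x = restrict-unique (_∘Aut_ ∏K ∏ℚ Σ Τ) (begin
      Aut.to Σ (Aut.to Τ (K₀ x))       ≈⟨ Aut.⟦⟧-cong Σ {Aut.to Τ (K₀ x)} {K₀ (restrict Τ x)} (to-const Τ x) ⟩
      Aut.to Σ (K₀ (restrict Τ x))     ≈⟨ to-const Σ (restrict Τ x) ⟩
      K₀ (restrict Σ (restrict Τ x))   ∎)
    injective : ∀ Σ Τ → (∀ x → restrict Σ x ≈ restrict Τ x) → ∀ φ → Aut.to Σ φ L.≈ Aut.to Τ φ
    injective Σ Τ same φ = begin
      Aut.to Σ φ
        ≈⟨ Restrict.to-determined Σ φ ⟩
      combination (restrict Σ ∘ basis) φ
        ≈⟨ ∑.sum-cong {x = λ j → coordinateᶜ j φ L.* K₀ (restrict Σ (basis j))}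
             {λ j → coordinateᶜ j φ L.* K₀ (restrict Τ (basis j))} (λ j →
             L.*-congˡ {coordinateᶜ j φ} {K₀ (restrict Σ (basis j))} {K₀ (restrict Τ (basis j))}
               (const-cong (same (basis j)))) ⟩
      combination (restrict Τ ∘ basis) φ
        ≈⟨ Restrict.to-determined Τ φ ⟨
      Aut.to Τ φ ∎

corollary3p9 : ExcludedMiddle 0ℓ →
    (K : CommutativeRing 0ℓ 0ℓ) (numberField : IsNumberField K)
    (P : ComputablePresentation K) (C : Pred ℕ 0ℓ) → Cohesive C →
    let ℚ⊆K = IsNumberField.ratl numberField in
    IsGalois K ℚ⊆K →
    IsGalois (∏ P C) (∏-sub P C ℚ⊆K) ×
    Gal (∏ P C) (∏-sub P C ℚ⊆K) ≅ Gal K ℚ⊆K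
corollary3p9 em K numberField P C cohesive galois = ∏-isGalois , Gal-∏≅Gal
  where open GaloisPower em numberField P cohesive galois
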